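{- The following hold. (1) $\mathsf{NPSV_t} \subseteq \mathsf{TotP}$ if and only if $\mathsf{P} = \mathsf{NP} \cap \mathsf{coNP}$. (2) $\mathsf{NPSV_t} \subseteq \mathsf{\#P}$ if and only if $\mathsf{UP} \cap \mathsf{coUP} = \mathsf{NP} \cap \mathsf{coNP}$. (3) $\mathsf{NPSV_t} \subseteq \mathsf{GapP}_{+}$ if and only if $\mathsf{NP} \cap \mathsf{coNP} \subseteq \mathsf{SPP}$.
   Context: NPTM means nondeterministic polynomial-time bounded Turing machine. For an NPTM $M$ and $x \in \Sigma^*$, $acc_M(x)$, $rej_M(x)$, $Total_M(x)$ are the numbers of accepting, rejecting and all computation paths of $M$ on $x$; $gap_M(x) = acc_M(x) - rej_M(x)$ and $tot_M(x) = Total_M(x) - 1$. The classes $\mathsf{\#P}$, $\mathsf{GapP}$, $\mathsf{TotP}$ consist of all functions $acc_M$, $gap_M$, $tot_M$, respectively, with $M$ an NPTM; $\mathsf{GapP}_{+}$ is the set of non-negative valued functions in $\mathsf{GapP}$. $\mathsf{NPSV_t}$ is the class of total functions $f$ on $\Sigma^*$ for which there is an NPTM that on every input $x \in \Sigma^*$ has at least one accepting path and outputs $f(x)$ on every accepting path; here $\mathsf{NPSV_t}$ is assumed to contain only non-negative integer valued functions (values written in binary). $\mathsf{UP}$ is the class of languages $L$ for which there is $f \in \mathsf{\#P}$ with $f(x)=1$ if $x \in L$ and $f(x)=0$ if $x \notin L$; $\mathsf{SPP}$ is defined in the same way with $f \in \mathsf{GapP}$. $\mathsf{coUP}$ and $\mathsf{coNP}$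 are the classes of complements of languages in $\mathsf{UP}$ and $\mathsf{NP}$. -}

module Defs where

open import Level using (0ℓ) renaming (suc to lsuc)
open import Data.Bool.Base using (Bool; true; false; not; _∨_; T)
open import Data.Nat.Base using (ℕ; zero; suc; pred; _+_; _*_; _<_)
open import Data.Integer.Base using (ℤ; +_; _-_)
open import Data.Digit using (Bit; toDigits)
open import Data.Fin.Base using (Fin)
open import Data.List.Base as List
  using (List; []; _∷_; [_]; _++_; length; reverse; fromMaybe; concatMap; filterᵇ)
open import Data.List.NonEmpty.Base as List⁺ using (List⁺; toList)
open import Data.List.Relation.Unary.All using (All)
open import Data.Maybe.Base using (Maybe)
open import Data.Product.Base using (Σ-syntax; ∃-syntax; _×_; _,_; proj₁)
open import Data.Vec.Base as Vec using (Vec)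
open import Function.Base using (_∘_)
open import Function.Bundles using (_↔_; _⇔_)
open import Relation.Binary.PropositionalEquality.Core using (_≡_)
open import Relation.Unary using (Pred)

-- Words over Σ = {0,1}.
Word : Set
Word = List Bit

-- A language is given by its characteristic function.  Every class below
-- consists of decidable languages, so no language is lost.
Language : Set
Language = Word → Bool

∁ : Language → Language
∁ L = not ∘ L

-- Most significant bit first, no leading zeros; 0 is written "0".
binary : ℕ → Word
binary n = reverse (proj₁ (toDigits 2 n))

Finite : Set → Set
Finite A = ∃[ n ] (A ↔ Fin n)

data Polynomial : Set where
  var     : Polynomial
  con     : ℕ → Polynomial
  _⊕_ _⊗_ : Polynomial → Polynomial → Polynomial

eval : Polynomial → ℕ → ℕ
eval var     n = n
eval (con c) n = c
eval (p ⊕ q) n = eval p n + eval q n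
eval (p ⊗ q) n = eval p n * eval q n

-- The tape alphabet: the blank, the input alphabet and auxiliary symbols.
data Symbol (G : Set) : Set where
  blank : Symbol G
  bit   : Bit → Symbol G
  aux   : G → Symbol G

-- A two-way infinite tape: `left` lists the cells to the left of the head,
-- nearest first, `right` those to the right, nearest first; all cells beyond
-- the two lists are blank.
record Tape (G : Set) : Set where
  constructor tape
  field
    left  : List (Symbol G)
    head  : Symbol G
    right : List (Symbol G)

open Tape public

data Direction : Set where
  goLeft stay goRight : Direction

module _ {G : Set} where

  fromCells : List (Symbol G) → Tape G
  fromCells []       = tape [] blank []
  fromCells (s ∷ ss) = tape [] s ss

  write : Symbol G → Tape G → Tape G
  write s (tape l _ r) = tape l s r

  move : Direction → Tape G → Tape G
  move goLeft  (tape []      h r)       = tape [] blank (h ∷ r)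
  move goLeft  (tape (s ∷ l) h r)       = tape l s (h ∷ r)
  move stay    t                        = t
  move goRight (tape l       h [])      = tape (h ∷ l) blank []
  move goRight (tape l       h (s ∷ r)) = tape (h ∷ l) s r

data Control (Q : Set) : Set where
  run           : Q → Control Q
  accept reject : Control Q

-- `emit` is the bit, if any, appended to a write-only output tape.
record Transition (Q G : Set) (k : ℕ) : Set where
  field
    next    : Control Q
    actions : Vec (Symbol G × Direction) k
    emit    : Maybe Bit

open Transition public

-- Nondeterministic Turing machines with `suc extraTapes` read-write tapes, the
-- first of which initially holds the input, and a write-only output tape.
-- Distinct entries of `δ q ss` are distinct nondeterministic choices.
record Machine : Set₁ where
  field
    Q          : Set
    Q-finite   : Finite Q
    G          : Set
    G-finite   : Finite G
    extraTapes : ℕ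
    start      : Q
    δ          : Q → Vec (Symbol G) (suc extraTapes) →
                 List⁺ (Transition Q G (suc extraTapes))

record Config (M : Machine) : Set where
  constructor config
  open Machine M
  field
    control : Control Q
    tapes   : Vec (Tape G) (suc extraTapes)
    output  : Word

open Config public

module _ (M : Machine) where
  open Machine M

  initial : Word → Config M
  initial x = config (run start)
    (fromCells (List.map bit x) Vec.∷ Vec.replicate extraTapes (fromCells [])) []

  apply : Vec (Tape G) (suc extraTapes) → Word →
          Transition Q G (suc extraTapes) → Config M
  apply ts w t = config (next t)
    (Vec.zipWith (λ (s , d) → move d ∘ write s) (actions t) ts)
    (w ++ fromMaybe (emit t))

  -- A halted configuration is its own unique successor, so that below a path
  -- that has already halted is still counted exactly once.
  successors : Config M → List (Config M)
  successors (config (run q) ts w) =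
    List.map (apply ts w) (toList (δ q (Vec.map head ts)))
  successors c = [ c ]

  -- One entry per computation path from c, cut off after n steps: the
  -- configuration in which that path ends.
  ends : ℕ → Config M → List (Config M)
  ends zero    c = [ c ]
  ends (suc n) c = concatMap (ends n) (successors c)

module _ {M : Machine} where

  accepting : Config M → Bool
  accepting (config accept _ _) = true
  accepting _                   = false

  rejecting : Config M → Bool
  rejecting (config reject _ _) = true
  rejecting _                   = false

  Halted : Config M → Set
  Halted c = T (accepting c ∨ rejecting c)

Deterministic : Machine → Set
Deterministic M = ∀ q ss → List⁺.length (δ q ss) ≡ 1
  where open Machine M

record NPTM : Set₁ where
  field
    machine : Machine
    time    : Polynomial
    halts   : ∀ x → All Halted (ends machine (eval time (length x)) (initial machine x))

open NPTM public

-- The final configurations of all computation paths of M on x, one per path.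
outcomes : (M : NPTM) → Word → List (Config (machine M))
outcomes M x = ends (machine M) (eval (time M) (length x)) (initial (machine M) x)

acc rej Total tot : NPTM → Word → ℕ
acc   M x = length (filterᵇ accepting (outcomes M x))
rej   M x = length (filterᵇ rejecting (outcomes M x))
Total M x = length (outcomes M x)
tot   M x = pred (Total M x)  -- Total M x is never 0

gap : NPTM → Word → ℤ
gap M x = + acc M x - + rej M x

FunctionClass : Set₂
FunctionClass = Pred (Word → ℕ) (lsuc 0ℓ)

LanguageClass : Set₂
LanguageClass = Pred Language (lsuc 0ℓ)

#P TotP GapP₊ NPSVₜ : FunctionClass
GapP : Pred (Word → ℤ) (lsuc 0ℓ)

#P   f = Σ[ M ∈ NPTM ] (∀ x → f x ≡ acc M x)
TotP f = Σ[ M ∈ NPTM ] (∀ x → f x ≡ tot M x)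
GapP f = Σ[ M ∈ NPTM ] (∀ x → f x ≡ gap M x)

-- Non-negative integer valued functions are regarded as functions into ℕ.
GapP₊ f = GapP (λ x → + f x)

NPSVₜ f = Σ[ M ∈ NPTM ] (∀ x →
  0 < acc M x ×
  All (λ c → T (accepting c) → output c ≡ binary (f x)) (outcomes M x))

_Accepts_ : NPTM → Language → Set
M Accepts L = ∀ x → L x ≡ true ⇔ 0 < acc M x

P NP UP SPP : LanguageClass
P   L = Σ[ M ∈ NPTM ] (Deterministic (machine M) × M Accepts L)
NP  L = Σ[ M ∈ NPTM ] (M Accepts L)
UP  L = Σ[ f ∈ (Word → ℕ) ] (#P f ×
  (∀ x → (L x ≡ true → f x ≡ 1) × (L x ≡ false → f x ≡ 0)))
SPP L = Σ[ f ∈ (Word → ℤ) ] (GapP f ×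
  (∀ x → (L x ≡ true → f x ≡ + 1) × (L x ≡ false → f x ≡ + 0)))

co : LanguageClass → LanguageClass
co C L = C (∁ L)

coNP coUP : LanguageClass
coNP = co NP
coUP = co UP

{-# OPTIONS --safe #-}

-- An indicator function of L ∈ NP ∩ coNP is in NPSVₜ: guess a machine for L or for its
-- complement, run it, and output 1 or 0.  This gives the three implications from left to
-- right, where for TotP a machine with one or two paths is made deterministic by accepting
-- as soon as it branches.
--
-- Conversely, for f ∈ NPSVₜ consider the language of the pairs (x, 0…01u) for which the
-- binary digit of f x of weight 2 ^ |u| is 1.  It is in NP ∩ coNP, and for a large enough
-- width m exactly f x words y of length m satisfy (x, y).  Hence guessing y and running a
-- UP (or SPP) machine on (x, y) gives f x accepting paths (or gap f x).  If the language is
-- decided deterministically, the digits of f x can be queried one after the other along a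
-- single path, which forks off 2 ^ i further paths whenever the digit of weight 2 ^ i is 1.
module Submission where

open import Defs
open import Algebra.Properties.CommutativeSemigroup using (x∙yz≈y∙xz; interchange)
open import Data.Bool.Base using (Bool; true; false; not; _∨_; _∧_; if_then_else_; T)
open import Data.Bool.Properties using (∧-identityʳ; ∧-zeroʳ; not-involutive; ⇔→≡)
open import Data.Digit using (Bit; 0b; 1b; toDigits; fromDigits)
open import Data.Empty using (⊥-elim)
open import Data.Fin.Base using (Fin; zero; suc; toℕ; fromℕ; inject₁)
open import Data.Fin.Properties using (+↔⊎; *↔×; 1↔⊤; 2↔Bool; toℕ-fromℕ; toℕ-inject₁)
open import Data.Integer.Base as ℤ using (ℤ)
import Data.Integer.Properties as ℤP
open import Data.List.Base as List
  using (List; []; _∷_; [_]; _++_; _ʳ++_; concatMap; filterᵇ; length; replicate; reverse)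
open import Data.List.NonEmpty.Base as List⁺ using (List⁺; toList; _∷_)
open import Data.List.Properties
  using ( ++-identityʳ; map-id; map-cong; map-∘; map-++; map-concatMap
        ; concatMap-cong; concatMap-map; concatMap-++; concatMap-pure
        ; length-++; length-map; length-replicate; length-reverse; reverse-++; reverse-involutive)
open import Data.List.Relation.Binary.Pointwise as Pw using (Pointwise; []; _∷_)
open import Data.List.Relation.Unary.All as All using (All; []; _∷_)
import Data.List.Relation.Unary.All.Properties as AllP
open import Data.Maybe.Base using (Maybe; nothing; just)
open import Data.Nat.Base
  using (ℕ; zero; suc; pred; _+_; _*_; _^_; _∸_; _≤_; _<_; _<ᵇ_; z≤n; s≤s)
open import Data.Nat.ListAction using (sum)
open import Data.Nat.ListAction.Properties using (sum-++)
open import Data.Nat.Properties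
open import Data.Product.Base using (Σ-syntax; _×_; _,_; proj₁; proj₂; map₁; uncurry)
open import Data.Product.Function.NonDependent.Propositional using (_×-↔_)
open import Data.Sum.Base using (_⊎_; inj₁; inj₂)
open import Data.Sum.Function.Propositional using (_⊎-↔_)
open import Data.Unit.Base using (⊤; tt)
open import Data.Vec.Base as Vec using (Vec; []; _∷_)
import Data.Vec.Properties as VecP
open import Data.Vec.Relation.Binary.Pointwise.Inductive as VecPw using ([]; _∷_)
open import Function.Base using (id; _∘_)
open import Function.Bundles using (_↔_; _⇔_; mk↔ₛ′; mk⇔; Equivalence)
open import Function.Construct.Composition using (_↔-∘_; _⇔-∘_)
open import Function.Construct.Identity using (↔-id)
open import Function.Construct.Symmetry using (↔-sym; ⇔-sym)
open import Relation.Binary.PropositionalEquality hiding ([_])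
open import Relation.Unary using (_⊆_; _∩_; _≐_)

-- Finite types and polynomials

-- An accepting path of a machine for `f` carries all of `f x`, so one machine certifies both that a
-- digit is 1 and that it is not: only the final test is negated, and totality of `f` supplies a
-- path for it. The padding turns weights into numbers of witnesses, as there are 2 ^ i words `u` of
-- length i. A path emits at most one bit per step, so the running time bounds the number of digits;
-- it is rounded up to (|x| + 2) ^ D because a machine has to guess exactly that many bits, and a
-- power is easily counted out by nested sweeps over the input. TotP counts rejecting paths too, so
-- guesses with a negative answer cannot be discarded. Part (1) therefore avoids guessing and reuses
-- one decider for all queries, which requires its tapes to be restored in between. The machines are
-- concrete and the counts have to be exact. Simulations therefore match the lists of successors
-- entry by entry, not just reachability, and compare tapes only up to trailing blanks.

finite-Fin : ∀ n → Finite (Fin n)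
finite-Fin n = n , ↔-id _

finite-↔ : {A B : Set} → A ↔ B → Finite B → Finite A
finite-↔ A↔B (n , B↔n) = n , B↔n ↔-∘ A↔B

finite-⊎ : {A B : Set} → Finite A → Finite B → Finite (A ⊎ B)
finite-⊎ (m , A↔m) (n , B↔n) = m + n , ↔-sym +↔⊎ ↔-∘ (A↔m ⊎-↔ B↔n)

finite-× : {A B : Set} → Finite A → Finite B → Finite (A × B)
finite-× (m , A↔m) (n , B↔n) = m * n , ↔-sym *↔× ↔-∘ (A↔m ×-↔ B↔n)

finite-Vec : {A : Set} → Finite A → ∀ k → Finite (Vec A k)
finite-Vec A-fin zero    = 1 , ↔-sym 1↔⊤ ↔-∘
  mk↔ₛ′ (λ _ → tt) (λ _ → []) (λ _ → refl) (λ { [] → refl })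
finite-Vec A-fin (suc k) = finite-↔
  (mk↔ₛ′ (λ { (x ∷ xs) → x , xs }) (uncurry _∷_) (λ _ → refl) (λ { (_ ∷ _) → refl }))
  (finite-× A-fin (finite-Vec A-fin k))

finite-Symbol : {G : Set} → Finite G → Finite (Symbol G)
finite-Symbol G-fin = finite-↔
  (mk↔ₛ′ (λ { blank → inj₁ zero ; (bit b) → inj₂ (inj₁ b) ; (aux g) → inj₂ (inj₂ g) })
         (λ { (inj₁ _) → blank ; (inj₂ (inj₁ b)) → bit b ; (inj₂ (inj₂ g)) → aux g })
         (λ { (inj₁ zero) → refl ; (inj₂ (inj₁ _)) → refl ; (inj₂ (inj₂ _)) → refl })
         (λ { blank → refl ; (bit _) → refl ; (aux _) → refl }))
  (finite-⊎ (finite-Fin 1) (finite-⊎ (finite-Fin 2) G-fin))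

compose : Polynomial → Polynomial → Polynomial
compose var     q = q
compose (con c) q = con c
compose (p ⊕ r) q = compose p q ⊕ compose r q
compose (p ⊗ r) q = compose p q ⊗ compose r q

eval-compose : ∀ p q n → eval (compose p q) n ≡ eval p (eval q n)
eval-compose var     q n = refl
eval-compose (con c) q n = refl
eval-compose (p ⊕ r) q n = cong₂ _+_ (eval-compose p q n) (eval-compose r q n)
eval-compose (p ⊗ r) q n = cong₂ _*_ (eval-compose p q n) (eval-compose r q n)

eval-mono : ∀ p {m n} → m ≤ n → eval p m ≤ eval p n
eval-mono var     m≤n = m≤n
eval-mono (con c) m≤n = ≤-refl
eval-mono (p ⊕ q) m≤n = +-mono-≤ (eval-mono p m≤n) (eval-mono q m≤n)
eval-mono (p ⊗ q) m≤n = *-mono-≤ (eval-mono p m≤n) (eval-mono q m≤n)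

-- Tapes up to trailing blanks

at : {G : Set} → List (Symbol G) → ℕ → Symbol G
at []       _       = blank
at (s ∷ _)  zero    = s
at (_ ∷ ss) (suc n) = at ss n

at-blanks : {G : Set} (ss : List (Symbol G)) → ∀ n → at (ss ++ [ blank ]) n ≡ at ss n
at-blanks []       zero    = refl
at-blanks []       (suc n) = refl
at-blanks (s ∷ ss) zero    = refl
at-blanks (s ∷ ss) (suc n) = at-blanks ss n

act : {G : Set} → Symbol G × Direction → Tape G → Tape G
act (s , d) = move d ∘ write s

keep : {G : Set} → Symbol G → Symbol G × Direction
keep s = s , stay

-- As cells are compared with `at`, trailing blanks do not matter.
record Shows {G H : Set} (look : Symbol G → Symbol H) (t : Tape G) (u : Tape H) : Set where
  field
    lefts  : ∀ n → look (at (left t) n) ≡ at (left u) n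
    here   : look (head t) ≡ head u
    rights : ∀ n → look (at (right t) n) ≡ at (right u) n

open Shows public

module _ {G : Set} where

  left-goLeft : (t : Tape G) → ∀ n → at (left (move goLeft t)) n ≡ at (left t) (suc n)
  left-goLeft (tape []      _ _) n = refl
  left-goLeft (tape (_ ∷ _) _ _) n = refl

  head-goLeft : (t : Tape G) → head (move goLeft t) ≡ at (left t) 0
  head-goLeft (tape []      _ _) = refl
  head-goLeft (tape (_ ∷ _) _ _) = refl

  right-goLeft : (t : Tape G) → right (move goLeft t) ≡ head t ∷ right t
  right-goLeft (tape []      _ _) = refl
  right-goLeft (tape (_ ∷ _) _ _) = refl

  left-goRight : (t : Tape G) → left (move goRight t) ≡ head t ∷ left t
  left-goRight (tape _ _ [])      = refl
  left-goRight (tape _ _ (_ ∷ _)) = refl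

  head-goRight : (t : Tape G) → head (move goRight t) ≡ at (right t) 0
  head-goRight (tape _ _ [])      = refl
  head-goRight (tape _ _ (_ ∷ _)) = refl

  right-goRight : (t : Tape G) → ∀ n → at (right (move goRight t)) n ≡ at (right t) (suc n)
  right-goRight (tape _ _ [])      n = refl
  right-goRight (tape _ _ (_ ∷ _)) n = refl

bits : {G : Set} → Word → List (Symbol G)
bits = List.map bit

-- A host alphabet `G` carrying a simulated alphabet `H`. Bits are shared, so that a word written by
-- the host can be read by the simulated machine; `look` need not be injective, and the two views of
-- a sum alphabet read foreign symbols as blank.
record View (G H : Set) : Set where
  field
    look       : Symbol G → Symbol H
    put        : Symbol H → Symbol G
    look-blank : look blank ≡ blank
    look-put   : ∀ s → look (put s) ≡ s
    look-bit   : ∀ b → look (bit b) ≡ bit b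

  lift : Symbol H × Direction → Symbol G × Direction
  lift = map₁ put

  act-Shows : ∀ {t : Tape G} {u : Tape H} {s s′} d → look s ≡ s′ → Shows look t u →
              Shows look (act (s , d) t) (act (s′ , d) u)
  act-Shows {t} {u} {s} {s′} goLeft eq sh = record
    { lefts  = λ n → trans (cong look (left-goLeft (write s t) n))
        (trans (lefts sh (suc n)) (sym (left-goLeft (write s′ u) n)))
    ; here   = trans (cong look (head-goLeft (write s t)))
        (trans (lefts sh 0) (sym (head-goLeft (write s′ u))))
    ; rights = λ n → trans (cong (λ r → look (at r n)) (right-goLeft (write s t)))
        (trans (beyond n) (cong (λ r → at r n) (sym (right-goLeft (write s′ u)))))
    }
    where
    beyond : ∀ n → look (at (s ∷ right t) n) ≡ at (s′ ∷ right u) n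
    beyond zero    = eq
    beyond (suc n) = rights sh n
  act-Shows stay eq sh = record { lefts = lefts sh ; here = eq ; rights = rights sh }
  act-Shows {t} {u} {s} {s′} goRight eq sh = record
    { lefts  = λ n → trans (cong (λ r → look (at r n)) (left-goRight (write s t)))
        (trans (beyond n) (cong (λ r → at r n) (sym (left-goRight (write s′ u)))))
    ; here   = trans (cong look (head-goRight (write s t)))
        (trans (rights sh 0) (sym (head-goRight (write s′ u))))
    ; rights = λ n → trans (cong look (right-goRight (write s t) n))
        (trans (rights sh (suc n)) (sym (right-goRight (write s′ u) n)))
    }
    where
    beyond : ∀ n → look (at (s ∷ left t) n) ≡ at (s′ ∷ left u) n
    beyond zero    = eq
    beyond (suc n) = lefts sh n

  _Shows*_ : ∀ {k} → Vec (Tape G) k → Vec (Tape H) k → Set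
  ts Shows* us = VecPw.Pointwise (Shows look) ts us

  heads-Shows* : ∀ {k} {ts : Vec (Tape G) k} {us : Vec (Tape H) k} → ts Shows* us →
                 Vec.map look (Vec.map head ts) ≡ Vec.map head us
  heads-Shows* []         = refl
  heads-Shows* (sh ∷ shs) = cong₂ _∷_ (here sh) (heads-Shows* shs)

  act-Shows* : ∀ {k} {ts : Vec (Tape G) k} {us : Vec (Tape H) k} as → ts Shows* us →
               Vec.zipWith act (Vec.map lift as) ts Shows* Vec.zipWith act as us
  act-Shows* []             []         = []
  act-Shows* ((s , d) ∷ as) (sh ∷ shs) = act-Shows d (look-put s) sh ∷ act-Shows* as shs

  bits-Shows : ∀ w → Shows look (fromCells (bits w)) (fromCells (bits w))
  bits-Shows []      = record
    { lefts = λ _ → look-blank ; here = look-blank ; rights = λ _ → look-blank }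
  bits-Shows (b ∷ w) = record
    { lefts = λ _ → look-blank ; here = look-bit b ; rights = each w }
    where
    each : ∀ w n → look (at (bits w) n) ≡ at (bits w) n
    each []      n       = look-blank
    each (b ∷ w) zero    = look-bit b
    each (b ∷ w) (suc n) = each w n

  blanks-Shows* : ∀ k → Vec.replicate k (fromCells []) Shows* Vec.replicate k (fromCells [])
  blanks-Shows* zero    = []
  blanks-Shows* (suc k) =
    record { lefts = λ _ → look-blank ; here = look-blank ; rights = λ _ → look-blank }
    ∷ blanks-Shows* k

idView : ∀ {G} → View G G
idView = record
  { look = id ; put = id ; look-blank = refl ; look-put = λ _ → refl
  ; look-bit = λ _ → refl }

leftView : {A B : Set} → View (A ⊎ B) A
leftView {A} {B} = record
  { look = look ; put = put ; look-blank = refl ; look-put = look-put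
  ; look-bit = λ _ → refl }
  where
  look : Symbol (A ⊎ B) → Symbol A
  look blank          = blank
  look (bit b)        = bit b
  look (aux (inj₁ a)) = aux a
  look (aux (inj₂ _)) = blank
  put : Symbol A → Symbol (A ⊎ B)
  put blank   = blank
  put (bit b) = bit b
  put (aux a) = aux (inj₁ a)
  look-put : ∀ s → look (put s) ≡ s
  look-put blank   = refl
  look-put (bit _) = refl
  look-put (aux _) = refl

rightView : {A B : Set} → View (A ⊎ B) B
rightView {A} {B} = record
  { look = look ; put = put ; look-blank = refl ; look-put = look-put
  ; look-bit = λ _ → refl }
  where
  look : Symbol (A ⊎ B) → Symbol B
  look blank          = blank
  look (bit b)        = bit b
  look (aux (inj₁ _)) = blank
  look (aux (inj₂ b)) = aux b
  put : Symbol B → Symbol (A ⊎ B)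
  put blank   = blank
  put (bit b) = bit b
  put (aux b) = aux (inj₂ b)
  look-put : ∀ s → look (put s) ≡ s
  look-put blank   = refl
  look-put (bit _) = refl
  look-put (aux _) = refl

module _ {G : Set} where

  infix 4 _≈ₜ_ _≈*_

  _≈ₜ_ : Tape G → Tape G → Set
  _≈ₜ_ = Shows id

  _≈*_ : ∀ {k} → Vec (Tape G) k → Vec (Tape G) k → Set
  _≈*_ = VecPw.Pointwise _≈ₜ_

  ≈ₜ-refl : ∀ {t} → t ≈ₜ t
  ≈ₜ-refl = record { lefts = λ _ → refl ; here = refl ; rights = λ _ → refl }

  ≡⇒≈ₜ : ∀ {t u} → t ≡ u → t ≈ₜ u
  ≡⇒≈ₜ refl = ≈ₜ-refl

  Shows-∘ : ∀ {H : Set} {look : Symbol G → Symbol H} {t u v} →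
            t ≈ₜ u → Shows look u v → Shows look t v
  Shows-∘ {look = look} p q = record
    { lefts  = λ n → trans (cong look (lefts p n)) (lefts q n)
    ; here   = trans (cong look (here p)) (here q)
    ; rights = λ n → trans (cong look (rights p n)) (rights q n)
    }

  Shows*-∘ : ∀ {H : Set} {look : Symbol G → Symbol H} {k} {ts us : Vec (Tape G) k} {vs : Vec (Tape H) k} →
             ts ≈* us → VecPw.Pointwise (Shows look) us vs → VecPw.Pointwise (Shows look) ts vs
  Shows*-∘ = VecPw.trans Shows-∘

  ≈*-refl : ∀ {k} {ts : Vec (Tape G) k} → ts ≈* ts
  ≈*-refl = VecPw.refl ≈ₜ-refl

  ≈*-reflexive : ∀ {k} {ts us : Vec (Tape G) k} → ts ≡ us → ts ≈* us
  ≈*-reflexive refl = ≈*-refl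

  act-keep : ∀ {k} (ts : Vec (Tape G) k) →
             Vec.zipWith act (Vec.map keep (Vec.map head ts)) ts ≡ ts
  act-keep []       = refl
  act-keep (t ∷ ts) = cong (t ∷_) (act-keep ts)

  -- The head is on the first cell of r, respectively of l.
  focus focusˡ : List (Symbol G) → List (Symbol G) → Tape G
  focus l []      = tape l blank []
  focus l (s ∷ r) = tape l s r
  focusˡ []      r = tape [] blank r
  focusˡ (s ∷ l) r = tape l s r

  goRight-focus : ∀ l s r → move goRight (tape l s r) ≡ focus (s ∷ l) r
  goRight-focus l s []      = refl
  goRight-focus l s (_ ∷ _) = refl

  goLeft-focus : ∀ l s r → move goLeft (tape l s r) ≡ focusˡ l (s ∷ r)
  goLeft-focus []      s r = refl
  goLeft-focus (_ ∷ _) s r = refl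

  focus-[] : ∀ r → focus [] r ≡ fromCells r
  focus-[] []      = refl
  focus-[] (_ ∷ _) = refl

  -- `move` never trims its lists, so a head that leaves a blank end cell stores that blank
  -- explicitly; such blanks are discarded here.
  blanks : ∀ l s r → tape (l ++ [ blank ]) s (r ++ [ blank ]) ≈ₜ tape l s r
  blanks l s r = record { lefts = at-blanks l ; here = refl ; rights = at-blanks r }

  blanksˡ : ∀ l s r → tape (l ++ [ blank ]) s r ≈ₜ tape l s r
  blanksˡ l s r = record { lefts = at-blanks l ; here = refl ; rights = λ _ → refl }

  blanksʳ : ∀ l s r → tape l s (r ++ [ blank ]) ≈ₜ tape l s r
  blanksʳ l s r = record { lefts = λ _ → refl ; here = refl ; rights = at-blanks r }

  goRight-blank : ∀ w → move goRight (tape [] blank (bits w)) ≈ₜ fromCells (bits w)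
  goRight-blank []      = blanksˡ [] blank []
  goRight-blank (b ∷ w) = blanksˡ [] (bit b) (bits w)

-- Computation trees

module _ {A B C : Set} where

  concatMap-concatMap : (f : B → List C) (g : A → List B) → ∀ xs →
    concatMap f (concatMap g xs) ≡ concatMap (λ x → concatMap f (g x)) xs
  concatMap-concatMap f g []       = refl
  concatMap-concatMap f g (x ∷ xs) =
    trans (concatMap-++ f (g x) (concatMap g xs))
          (cong (concatMap f (g x) ++_) (concatMap-concatMap f g xs))

Pw-concatMap : {A B C D : Set} {R : A → B → Set} {S : C → D → Set}
  {f : A → List C} {g : B → List D} → (∀ {x y} → R x y → Pointwise S (f x) (g y)) →
  ∀ {xs ys} → Pointwise R xs ys → Pointwise S (concatMap f xs) (concatMap g ys)
Pw-concatMap h []       = []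
Pw-concatMap h (r ∷ rs) = Pw.++⁺ (h r) (Pw-concatMap h rs)

Pw-mapʳ⁻ : {A B Y : Set} {R : A → B → Set} {g : Y → B} → ∀ {xs} ys →
  Pointwise R xs (List.map g ys) → Pointwise (λ x y → R x (g y)) xs ys
Pw-mapʳ⁻ []       []       = []
Pw-mapʳ⁻ (y ∷ ys) (r ∷ rs) = r ∷ Pw-mapʳ⁻ ys rs

Pw-map₂ : {A B Y : Set} {R : A → B → Set} {f : Y → A} {g : Y → B} →
  (∀ y → R (f y) (g y)) → ∀ ys → Pointwise R (List.map f ys) (List.map g ys)
Pw-map₂ r []       = []
Pw-map₂ r (y ∷ ys) = r y ∷ Pw-map₂ r ys

Pw-Allʳ : {A B : Set} {R : A → B → Set} {S : B → Set} → ∀ {xs ys} →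
  Pointwise R xs ys → All S ys → Pointwise (λ x y → R x y × S y) xs ys
Pw-Allʳ []       []       = []
Pw-Allʳ (r ∷ rs) (s ∷ ss) = (r , s) ∷ Pw-Allʳ rs ss

Pw-Allˡ : {A B : Set} {R : A → B → Set} {S : A → Set} → ∀ {xs ys} →
  Pointwise R xs ys → All S xs → Pointwise (λ x y → R x y × S x) xs ys
Pw-Allˡ []       []       = []
Pw-Allˡ (r ∷ rs) (s ∷ ss) = (r , s) ∷ Pw-Allˡ rs ss

All-concatMap⁻ : {A B : Set} {Q : B → Set} {f : A → List B} → ∀ xs →
  All Q (concatMap f xs) → All (All Q ∘ f) xs
All-concatMap⁻ []                _  = []
All-concatMap⁻ {f = f} (x ∷ xs) qs =
  AllP.++⁻ˡ (f x) qs ∷ All-concatMap⁻ xs (AllP.++⁻ʳ (f x) qs)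

concatMap-cong-All : {A B : Set} {f g : A → List B} → ∀ {xs} →
  All (λ x → f x ≡ g x) xs → concatMap f xs ≡ concatMap g xs
concatMap-cong-All []         = refl
concatMap-cong-All (eq ∷ eqs) = cong₂ _++_ eq (concatMap-cong-All eqs)

mapControl : {Q R : Set} → (Q → R) → Control Q → Control R
mapControl f (run q) = run (f q)
mapControl f accept  = accept
mapControl f reject  = reject

module _ {M : Machine} where

  ends-halted : ∀ n {c : Config M} → Halted c → ends M n c ≡ [ c ]
  ends-halted zero                          h = refl
  ends-halted (suc n) {config accept _ _} h = cong (_++ []) (ends-halted n {config _ _ _} h)
  ends-halted (suc n) {config reject _ _} h = cong (_++ []) (ends-halted n {config _ _ _} h)

  ends-+ : ∀ m n c → ends M (m + n) c ≡ concatMap (ends M n) (ends M m c)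
  ends-+ zero    n c = sym (++-identityʳ _)
  ends-+ (suc m) n c = trans
    (cong List.concat (map-cong (ends-+ m n) (successors M c)))
    (sym (concatMap-concatMap (ends M n) (ends M m) (successors M c)))

  -- Halted configurations are their own successors, so spare time is harmless and running times may
  -- be rounded up to a common bound.
  ends-stable : ∀ {m n c} → All Halted (ends M m c) → m ≤ n → ends M n c ≡ ends M m c
  ends-stable {m} {n} {c} hs m≤n = begin
    ends M n c                               ≡⟨ cong (λ k → ends M k c) (m+[n∸m]≡n m≤n) ⟨
    ends M (m + (n ∸ m)) c                   ≡⟨ ends-+ m _ c ⟩
    concatMap (ends M (n ∸ m)) (ends M m c)
      ≡⟨ concatMap-cong-All (All.map (λ {d} → ends-halted (n ∸ m) {d}) hs) ⟩
    concatMap [_] (ends M m c)               ≡⟨ concatMap-pure _ ⟩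
    ends M m c                               ∎
    where open ≡-Reasoning

  halted-mono : ∀ {m n c} → All Halted (ends M m c) → m ≤ n → All Halted (ends M n c)
  halted-mono {m} hs m≤n = subst (All Halted) (sym (ends-stable {m} hs m≤n)) hs

-- Successors are matched one to one and in order: multiplicities survive, and with them all path
-- counts.
Simulation : (M N : Machine) → (Config M → Config N → Set) → Set
Simulation M N R = ∀ {c d} → R c d → Pointwise R (successors M c) (successors N d)

ends-simulate : ∀ {M N} {R : Config M → Config N → Set} → Simulation M N R →
  ∀ n {c d} → R c d → Pointwise R (ends M n c) (ends N n d)
ends-simulate sim zero    r = r ∷ []
ends-simulate sim (suc n) r = Pw-concatMap (ends-simulate sim n) (sim r)

SameVerdict : {M N : Machine} → Config M → Config N → Set
SameVerdict c d = accepting c ≡ accepting d × rejecting c ≡ rejecting d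

SameVerdict-trans : ∀ {M N K} {c : Config M} {d : Config N} {e : Config K} →
  SameVerdict c d → SameVerdict d e → SameVerdict c e
SameVerdict-trans (a , r) (a′ , r′) = trans a a′ , trans r r′

SameVerdict-sym : ∀ {M N} {c : Config M} {d : Config N} → SameVerdict c d → SameVerdict d c
SameVerdict-sym (a , r) = sym a , sym r

SameVerdict-halted : ∀ {M N} {cs : List (Config M)} {ds : List (Config N)} →
  Pointwise (λ c d → SameVerdict c d) cs ds → All Halted ds → All Halted cs
SameVerdict-halted []             []       = []
SameVerdict-halted ((a , r) ∷ vs) (h ∷ hs) =
  subst T (sym (cong₂ _∨_ a r)) h ∷ SameVerdict-halted vs hs

-- Reachability with all branches listed, up to trailing blanks

module _ {M : Machine} where
  open Machine M

  infix 4 _≈_ _⟹[_]_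

  -- Equality up to trailing blanks and the output.
  data _≈_ : Config M → Config M → Set where
    same : ∀ {q v w} {ts us : Vec (Tape G) (suc extraTapes)} → ts ≈* us → config q ts v ≈ config q us w

  ≈-refl : ∀ {c} → c ≈ c
  ≈-refl = same ≈*-refl

  ≈-trans : ∀ {c d e} → c ≈ d → d ≈ e → c ≈ e
  ≈-trans (same p) (same q) = same (Shows*-∘ p q)

  ≈-verdict : ∀ {c d} → c ≈ d → SameVerdict c d
  ≈-verdict {config (run _) _ _} (same _) = refl , refl
  ≈-verdict {config accept  _ _} (same _) = refl , refl
  ≈-verdict {config reject  _ _} (same _) = refl , refl

  private
    act-≈* : ∀ {k} {ts us : Vec (Tape G) k} as → ts ≈* us →
             Vec.zipWith act as ts ≈* Vec.zipWith act as us
    act-≈* []       []       = []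
    act-≈* ((s , d) ∷ as) (p ∷ ps) = View.act-Shows idView d refl p ∷ act-≈* as ps

    heads-≈* : ∀ {k} {ts us : Vec (Tape G) k} → ts ≈* us → Vec.map head ts ≡ Vec.map head us
    heads-≈* []       = refl
    heads-≈* (p ∷ ps) = cong₂ _∷_ (here p) (heads-≈* ps)

  ≈-simulation : Simulation M M _≈_
  ≈-simulation {config (run q) ts v} {config _ us w} (same ps) rewrite heads-≈* ps =
    Pw-map₂ (λ t → same (act-≈* (actions t) ps)) _
  ≈-simulation {config accept _ _} p@(same _) = p ∷ []
  ≈-simulation {config reject _ _} p@(same _) = p ∷ []

  -- `ds` lists the ends of all paths after exactly `n` steps. As a record it determines `c` and
  -- `n`, which cannot be recovered from the computed list `ends M n c`.
  record _⟹[_]_ (c : Config M) (n : ℕ) (ds : List (Config M)) : Set where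
    constructor reach
    field ends≈ : Pointwise _≈_ (ends M n c) ds

  open _⟹[_]_ public

  ⟹-refl : ∀ {c d} → c ≈ d → c ⟹[ 0 ] [ d ]
  ⟹-refl p = reach (p ∷ [])

  ⟹-≈ : ∀ {n c d ds} → c ≈ d → d ⟹[ n ] ds → c ⟹[ n ] ds
  ⟹-≈ {n} p (reach r) = reach (Pw.transitive ≈-trans (ends-simulate ≈-simulation n p) r)

  ⟹-from : ∀ {n c d ds} → c ≡ d → d ⟹[ n ] ds → c ⟹[ n ] ds
  ⟹-from refl r = r

  ⟹-to : ∀ {n c ds es} → ds ≡ es → c ⟹[ n ] ds → c ⟹[ n ] es
  ⟹-to refl r = r

  -- All branches take the same time `n`, because `ends` cuts every path off at one common time. The
  -- guessing phase of `Asking` is timed accordingly.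
  ⟹-bind : ∀ {m n} {Y : Set} {c g} {h : Y → List (Config M)} {ys} →
           c ⟹[ m ] List.map g ys → (∀ y → g y ⟹[ n ] h y) → c ⟹[ m + n ] concatMap h ys
  ⟹-bind {m} {n} {c = c} {ys = ys} (reach r) s =
    reach (subst (λ es → Pointwise _≈_ es _) (sym (ends-+ {M} m n c))
      (Pw-concatMap (λ {_} {y} p → ends≈ (⟹-≈ p (s y))) (Pw-mapʳ⁻ ys r)))

  ⟹-then : ∀ {m n c d es} → c ⟹[ m ] [ d ] → d ⟹[ n ] es → c ⟹[ m + n ] es
  ⟹-then {d = d} {es} r s = ⟹-to (++-identityʳ es)
    (⟹-bind {g = λ (_ : ⊤) → d} {h = λ _ → es} {ys = tt ∷ []} r (λ _ → s))

  ⟹-step : ∀ {c ds} → Pointwise _≈_ (successors M c) ds → c ⟹[ 1 ] ds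
  ⟹-step {c} r = reach (subst (λ cs → Pointwise _≈_ cs _)
    (sym (concatMap-pure (successors M c))) r)

-- Guessing a word and asking a machine

-- A query is a word of pairs (tag, bit), with tag 0 for the bits of x and tag 1 for
-- those of ys.  Every word decodes, and as words are both encoded and decoded by
-- pushing, the two reversals cancel.
pushPairs : Bit → Word → Word → Word
pushPairs t []      w = w
pushPairs t (b ∷ u) w = pushPairs t u (t ∷ b ∷ w)

query : Word → Word → Word
query ys x = pushPairs 1b ys (pushPairs 0b x [])

length-pushPairs : ∀ t u w → length (pushPairs t u w) ≡ length u * 2 + length w
length-pushPairs t []      w = refl
length-pushPairs t (b ∷ u) w = trans (length-pushPairs t u (t ∷ b ∷ w))
  (trans (+-suc _ _) (cong suc (+-suc _ _)))

pushPairs-++ : ∀ t u v w → pushPairs t (u ++ v) w ≡ pushPairs t v (pushPairs t u w)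
pushPairs-++ t []      v w = refl
pushPairs-++ t (b ∷ u) v w = pushPairs-++ t u v (t ∷ b ∷ w)

-- The list `bs` selects the mode: both bits give all words of length `n`, the single bit 1 gives
-- just the word 1...1, produced without branching.
wordsOver : List Bit → ℕ → List Word
wordsOver bs zero    = [ [] ]
wordsOver bs (suc n) = concatMap (λ b → List.map (b ∷_) (wordsOver bs n)) bs

wordsOver-+ : ∀ bs m n → wordsOver bs (m + n) ≡
  concatMap (λ u → List.map (u ++_) (wordsOver bs n)) (wordsOver bs m)
wordsOver-+ bs zero    n = sym (trans (++-identityʳ _) (map-id _))
wordsOver-+ bs (suc m) n = begin
  concatMap (λ b → List.map (b ∷_) (W (m + n))) bs
    ≡⟨ concatMap-cong (λ b → trans (cong (List.map (b ∷_)) (wordsOver-+ bs m n)) (one b)) bs ⟩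
  concatMap (λ b → concatMap after (List.map (b ∷_) (W m))) bs
    ≡⟨ concatMap-concatMap after (λ b → List.map (b ∷_) (W m)) bs ⟨
  concatMap after (W (suc m)) ∎
  where
  open ≡-Reasoning
  W = wordsOver bs
  after = λ u → List.map (u ++_) (W n)
  one : ∀ b → List.map (b ∷_) (concatMap after (W m)) ≡ concatMap after (List.map (b ∷_) (W m))
  one b = begin
    List.map (b ∷_) (concatMap after (W m))      ≡⟨ map-concatMap (b ∷_) after (W m) ⟩
    concatMap (List.map (b ∷_) ∘ after) (W m)
      ≡⟨ concatMap-cong (λ u → sym (map-∘ (W n))) (W m) ⟩
    concatMap (λ u → after (b ∷ u)) (W m)        ≡⟨ concatMap-map after (b ∷_) (W m) ⟨
    concatMap after (List.map (b ∷_) (W m))      ∎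

length-wordsOver : ∀ bs n → All (λ w → length w ≡ n) (wordsOver bs n)
length-wordsOver bs zero    = refl ∷ []
length-wordsOver bs (suc n) = AllP.concat⁺ (AllP.map⁺ (All.universal
  (λ b → AllP.map⁺ (All.map (cong suc) (length-wordsOver bs n))) bs))

-- The clock is a stack of symbols j ≤ D: popping 0 emits a bit, popping j + 1
-- pushes |x| + 2 copies of j, one for each cell met while sweeping over x and two
-- more at its ends.  So the symbol D emits (|x| + 2) ^ D bits.  The tapes are the
-- input, the clock and those of N, the first of which receives the query.
module Asking (N : NPTM) (choices : List⁺ Bit) (D : ℕ) where
  open Machine (machine N)

  State Letter : Set
  State  = Fin 6 ⊎ Fin D ⊎ Q
  Letter = Fin (suc D) ⊎ G

  pattern copy    = inj₁ zero
  pattern copyTag = inj₁ (suc zero)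
  pattern pop     = inj₁ (suc (suc zero))
  pattern read    = inj₁ (suc (suc (suc zero)))
  pattern back    = inj₁ (suc (suc (suc (suc zero))))
  pattern tag     = inj₁ (suc (suc (suc (suc (suc zero)))))
  pattern sweep j = inj₂ (inj₁ j)
  pattern sim q   = inj₂ (inj₂ q)
  pattern clock j = aux (inj₁ j)

  open View (rightView {Fin (suc D)} {G})

  Step : Set
  Step = Transition State Letter (3 + extraTapes)

  go : State → Vec (Symbol Letter × Direction) (3 + extraTapes) → Step
  go q as = record { next = run q ; actions = as ; emit = nothing }

  simStep : Symbol Letter → Symbol Letter → Transition Q G (suc extraTapes) → Step
  simStep i c t = record
    { next = mapControl (λ q → sim q) (next t)
    ; actions = keep i ∷ keep c ∷ Vec.map lift (actions t)
    ; emit = nothing }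

  -- The query is written leftwards, each bit before its tag, so that from left to right it reads
  -- tag, bit with the latest pair in front, as in `pushPairs`.
  δ′ : State → Vec (Symbol Letter) (3 + extraTapes) → List⁺ Step
  δ′ copy (bit b ∷ c ∷ q ∷ ss) =
    go copyTag (keep (bit b) ∷ keep c ∷ (bit b , goLeft) ∷ Vec.map keep ss) ∷ []
  δ′ copy (i ∷ c ∷ q ∷ ss) =
    go pop (keep i ∷ (clock (fromℕ D) , goRight) ∷ keep q ∷ Vec.map keep ss) ∷ []
  δ′ copyTag (i ∷ c ∷ q ∷ ss) =
    go copy ((i , goRight) ∷ keep c ∷ (bit 0b , goLeft) ∷ Vec.map keep ss) ∷ []
  δ′ pop (i ∷ c ∷ q ∷ ss) =
    go read (keep i ∷ (c , goLeft) ∷ keep q ∷ Vec.map keep ss) ∷ []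
  -- This is the only branching before `N` starts. The erased cell becomes the blank above the
  -- shorter stack.
  δ′ read (i ∷ clock zero ∷ q ∷ ss) = List⁺.map (λ b →
    go tag (keep i ∷ keep blank ∷ (bit b , goLeft) ∷ Vec.map keep ss)) choices
  -- The first copy of j overwrites the popped symbol; the sweep pushes one per input bit and a last
  -- one at the left blank.
  δ′ read (i ∷ clock (suc j) ∷ q ∷ ss) =
    go (sweep j) ((i , goLeft) ∷ (clock (inject₁ j) , goRight) ∷ keep q ∷ Vec.map keep ss) ∷ []
  -- The stack is empty: the query is complete, and its head moves onto the first cell.
  δ′ read (i ∷ c ∷ q ∷ ss) =
    go (sim start) (keep i ∷ keep c ∷ (q , goRight) ∷ Vec.map keep ss) ∷ []
  δ′ back (bit b ∷ c ∷ q ∷ ss) =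
    go back ((bit b , goRight) ∷ keep c ∷ keep q ∷ Vec.map keep ss) ∷ []
  δ′ back (i ∷ c ∷ q ∷ ss) =
    go pop (keep i ∷ keep c ∷ keep q ∷ Vec.map keep ss) ∷ []
  δ′ tag (i ∷ c ∷ q ∷ ss) =
    go pop (keep i ∷ keep c ∷ (bit 1b , goLeft) ∷ Vec.map keep ss) ∷ []
  δ′ (sweep j) (bit b ∷ c ∷ q ∷ ss) =
    go (sweep j) ((bit b , goLeft) ∷ (clock (inject₁ j) , goRight) ∷ keep q ∷ Vec.map keep ss) ∷ []
  δ′ (sweep j) (i ∷ c ∷ q ∷ ss) =
    go back ((i , goRight) ∷ (clock (inject₁ j) , goRight) ∷ keep q ∷ Vec.map keep ss) ∷ []
  δ′ (sim q) (i ∷ c ∷ ss) = List⁺.map (simStep i c) (δ q (Vec.map look ss))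

  asker : Machine
  asker = record
    { Q          = State
    ; Q-finite   = finite-⊎ (finite-Fin 6) (finite-⊎ (finite-Fin D) Q-finite)
    ; G          = Letter
    ; G-finite   = finite-⊎ (finite-Fin (suc D)) G-finite
    ; extraTapes = 2 + extraTapes
    ; start      = copy
    ; δ          = δ′
    }

  conf : State → (i c q : Tape Letter) → Config asker
  conf st i c q = config (run st) (i ∷ c ∷ q ∷ Vec.replicate extraTapes (fromCells [])) []

  rest : Vec (Symbol Letter) extraTapes
  rest = Vec.map head (Vec.replicate extraTapes (fromCells []))

  step : ∀ {st st′ i i′ c c′ q q′ a₁ a₂ a₃} →
         δ′ st (head i ∷ head c ∷ head q ∷ rest) ≡
           go st′ (a₁ ∷ a₂ ∷ a₃ ∷ Vec.map keep rest) ∷ [] →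
         act a₁ i ≈ₜ i′ → act a₂ c ≈ₜ c′ → act a₃ q ≈ₜ q′ →
         conf st i c q ⟹[ 1 ] [ conf st′ i′ c′ q′ ]
  step {st} {st′} {i} {i′} {c} {c′} {q} {q′} eq p₁ p₂ p₃ = ⟹-step
    (subst (λ ts → Pointwise _≈_
        (List.map (apply asker (i ∷ c ∷ q ∷ Vec.replicate extraTapes (fromCells [])) []) (toList ts)) _)
      (sym eq) (same (p₁ ∷ p₂ ∷ p₃ ∷ ≈*-reflexive (act-keep _)) ∷ []))

  copies : ∀ r l w →
    conf copy (focus (bits l) (bits r)) (tape [] blank []) (tape [] blank (bits w))
      ⟹[ length r * 2 + 1 ]
    [ conf pop (tape (bits (r ʳ++ l)) blank []) (tape [ clock (fromℕ D) ] blank [])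
               (tape [] blank (bits (pushPairs 0b r w))) ]
  copies []      l w = step refl ≈ₜ-refl ≈ₜ-refl ≈ₜ-refl
  copies (b ∷ r) l w =
    ⟹-then (step {st′ = copyTag} refl ≈ₜ-refl ≈ₜ-refl ≈ₜ-refl)
    (⟹-then (step {st′ = copy} refl (≡⇒≈ₜ (goRight-focus (bits l) (bit b) (bits r))) ≈ₜ-refl ≈ₜ-refl)
    (copies r (b ∷ l) (0b ∷ b ∷ w)))

  replicate-++-∷ : ∀ n (s : Symbol Letter) ss → replicate n s ++ s ∷ ss ≡ s ∷ replicate n s ++ ss
  replicate-++-∷ zero    s ss = refl
  replicate-++-∷ (suc n) s ss = cong (s ∷_) (replicate-++-∷ n s ss)

  -- The blank to the right of `r` is the cell behind the input on which the head rests at each pop.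
  sweeps : ∀ j l r stk q →
    conf (sweep j) (focusˡ (bits l) (bits r ++ [ blank ])) (tape stk blank []) q
      ⟹[ length l + 1 ]
    [ conf back (focus [] (bits (l ʳ++ r)))
                (tape (replicate (suc (length l)) (clock (inject₁ j)) ++ stk) blank []) q ]
  sweeps j []      r stk q = step refl (blanks-focus r) ≈ₜ-refl ≈ₜ-refl
    where
    blanks-focus : ∀ r → move goRight (tape [] blank (bits r ++ [ blank ])) ≈ₜ focus [] (bits r)
    blanks-focus []      = blanksˡ [] blank []
    blanks-focus (b ∷ r) = blanks [] (bit b) (bits r)
  sweeps j (b ∷ l) r stk q = ⟹-then
    (step {st′ = sweep j} refl (≡⇒≈ₜ (goLeft-focus (bits l) (bit b) (bits r ++ [ blank ])))
      ≈ₜ-refl ≈ₜ-refl)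
    (⟹-to (cong (λ ss → [ conf back (focus [] (bits (l ʳ++ b ∷ r))) (tape ss blank []) q ])
      (replicate-++-∷ (suc (length l)) (clock (inject₁ j)) stk))
      (sweeps j l (b ∷ r) (clock (inject₁ j) ∷ stk) q))

  returns : ∀ r l c q →
    conf back (focus (bits l) (bits r)) c q
      ⟹[ length r + 1 ]
    [ conf pop (tape (bits (r ʳ++ l)) blank []) c q ]
  returns []      l c q = step refl ≈ₜ-refl ≈ₜ-refl ≈ₜ-refl
  returns (b ∷ r) l c q = ⟹-then
    (step {st′ = back} refl (≡⇒≈ₜ (goRight-focus (bits l) (bit b) (bits r))) ≈ₜ-refl ≈ₜ-refl)
    (returns r (b ∷ l) c q)

  -- Symbol 0 takes the steps of `pop`, `read` and `tag`. Symbol j + 1 takes `pop` and `read`, a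
  -- sweep to the left and one back of |x| + 1 steps each, and then |x| + 2 symbols j.
  T-clock : ℕ → Polynomial
  T-clock zero    = con 3
  T-clock (suc j) = con 2 ⊕ ((var ⊕ con 1) ⊕ ((var ⊕ con 1) ⊕ ((con 2 ⊕ var) ⊗ T-clock j)))

  words : ℕ → List Word
  words = wordsOver (toList choices)

  module _ (l : Word) where
    private
      n : ℕ
      n = length l

    at-pop : List (Symbol Letter) → Word → Config asker
    at-pop stk w = conf pop (tape (bits l) blank []) (tape stk blank []) (tape [] blank (bits w))

    record Emits (stk : List (Symbol Letter)) (t m : ℕ) (stk′ : List (Symbol Letter)) : Set where
      constructor emitting
      field emit : ∀ w →
              at-pop stk w ⟹[ t ] List.map (λ u → at-pop stk′ (pushPairs 1b u w)) (words m)
    open Emits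

    emits-then : ∀ {stk stk′ stk″ s t a b} →
      Emits stk s a stk′ → Emits stk′ t b stk″ → Emits stk (s + t) (a + b) stk″
    emits-then {stk} {stk′} {stk″} {s} {t} {a} {b} (emitting e) (emitting e′) = emitting λ w →
      ⟹-to (eq w) (⟹-bind (e w) (λ u → e′ (pushPairs 1b u w)))
      where
      open ≡-Reasoning
      eq : ∀ w →
        concatMap (λ u → List.map (λ v → at-pop stk″ (pushPairs 1b v (pushPairs 1b u w))) (words b)) (words a)
         ≡ List.map (λ u → at-pop stk″ (pushPairs 1b u w)) (words (a + b))
      eq w = begin
        _ ≡⟨ concatMap-cong (λ u → trans
               (map-cong (λ v → cong (at-pop stk″) (sym (pushPairs-++ 1b u v w))) (words b))
               (map-∘ (words b))) (words a) ⟩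
        concatMap (λ u → List.map (λ v → at-pop stk″ (pushPairs 1b v w)) (List.map (u ++_) (words b))) (words a)
          ≡⟨ map-concatMap _ _ (words a) ⟨
        List.map _ (concatMap (λ u → List.map (u ++_) (words b)) (words a))
          ≡⟨ cong (List.map _) (wordsOver-+ (toList choices) a b) ⟨
        _ ∎

    emits-many : ∀ {s t a} → (∀ stk → Emits (s ∷ stk) t a stk) →
      ∀ r stk → Emits (replicate r s ++ stk) (r * t) (r * a) stk
    emits-many e zero    stk = emitting λ w → ⟹-refl ≈-refl
    emits-many e (suc r) stk = emits-then (e _) (emits-many e r stk)

    -- The index `k` carries the recursion: the pushed symbol `inject₁ j` has the same value as `j`
    -- but is no structural part of `suc j`.
    emits : ∀ k j → toℕ j ≡ k → ∀ stk →
      Emits (clock j ∷ stk) (eval (T-clock k) n) ((2 + n) ^ k) stk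
    emits zero zero _ stk = emitting λ w →
      ⟹-then (step {st′ = read} {i′ = tape (bits l) blank []} {q′ = tape [] blank (bits w)}
                refl ≈ₜ-refl ≈ₜ-refl ≈ₜ-refl)
      (⟹-to (sym (map-concatMap (λ u → at-pop stk (pushPairs 1b u w))
                (λ b → List.map (b ∷_) (words 0)) (toList choices)))
        (⟹-bind {ys = toList choices}
          (⟹-step (subst (λ cs → Pointwise _≈_ cs (List.map (tagging w) (toList choices)))
            (map-∘ {g = apply asker (reading w) []} {f = choose} (toList choices))
            (Pw-map₂ {f = apply asker (reading w) [] ∘ choose}
              (λ b → same (≈ₜ-refl ∷ blanksʳ stk blank [] ∷ ≈ₜ-refl ∷ ≈*-reflexive (act-keep _)))
              (toList choices))))
          (λ b → step {st = tag} refl ≈ₜ-refl ≈ₜ-refl ≈ₜ-refl)))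
      where
      reading : Word → Vec (Tape Letter) (3 + extraTapes)
      reading w = tape (bits l) blank [] ∷ tape stk (clock zero) [ blank ] ∷
        tape [] blank (bits w) ∷ Vec.replicate extraTapes (fromCells [])
      choose : Bit → Step
      choose b = go tag (keep blank ∷ keep blank ∷ (bit b , goLeft) ∷ Vec.map keep rest)
      tagging : Word → Bit → Config asker
      tagging w b = conf tag (tape (bits l) blank []) (tape stk blank []) (tape [] blank (bits (b ∷ w)))
    emits (suc k) (suc j) refl stk = emitting λ w →
      ⟹-then (step {st′ = read} refl ≈ₜ-refl ≈ₜ-refl ≈ₜ-refl)
      (⟹-then (step {st′ = sweep j} refl (≡⇒≈ₜ (goLeft-focus (bits l) blank [])) ≈ₜ-refl ≈ₜ-refl)
      (⟹-then (sweeps j l [] (clock (inject₁ j) ∷ stk) _)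
      (⟹-then (returns′ _ _)
      (⟹-from (cong (λ ss → at-pop ss w)
        (replicate-++-∷ (suc n) (clock (inject₁ j)) stk))
        (emit (emits-many (emits k (inject₁ j) (toℕ-inject₁ j)) (2 + n) stk) w)))))
      where
      returns′ : ∀ c q → conf back (focus [] (bits (reverse l))) c q
                   ⟹[ n + 1 ] [ conf pop (tape (bits l) blank []) c q ]
      returns′ c q = subst₂ (λ m l′ → conf back (focus [] (bits (reverse l))) c q
                          ⟹[ m + 1 ] [ conf pop (tape (bits l′) blank []) c q ])
                (length-reverse l) (reverse-involutive l) (returns (reverse l) [] c q)

  -- Two steps per copied bit and one for pushing `D`; the last two pop the empty stack and start
  -- `N`.
  T-ask : Polynomial
  T-ask = ((var ⊗ con 2) ⊕ con 1) ⊕ (T-clock D ⊕ con 2)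

  data Hosts : Config (machine N) → Config asker → Set where
    hosts : ∀ {ctl i c v w} {ts : Vec _ (suc extraTapes)} {us} → ts Shows* us →
            Hosts (config ctl us v) (config (mapControl (λ q → sim q) ctl) (i ∷ c ∷ ts) w)

  hosts-simulation : Simulation (machine N) asker Hosts
  hosts-simulation (hosts {run q} {us = us} sh) rewrite heads-Shows* sh =
    subst (Pointwise Hosts _) (map-∘ (toList (δ q (Vec.map head us))))
      (Pw-map₂ (λ t → hosts (act-Shows* (actions t) sh)) (toList (δ q (Vec.map head us))))
  hosts-simulation (hosts {accept} sh) = hosts sh ∷ []
  hosts-simulation (hosts {reject} sh) = hosts sh ∷ []

  hosts-verdict : ∀ {c d} → Hosts c d → SameVerdict c d
  hosts-verdict (hosts {run _} _)  = refl , refl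
  hosts-verdict (hosts {accept} _) = refl , refl
  hosts-verdict (hosts {reject} _) = refl , refl

  started : Word → Word → Config asker
  started x ys = conf (sim start) (tape (bits (reverse x)) blank []) (tape [] blank [])
    (fromCells (bits (query ys x)))

  asks : ∀ x → initial asker x ⟹[ eval T-ask (length x) ]
         List.map (started x) (words ((2 + length x) ^ D))
  asks x = ⟹-then {m = length x * 2 + 1}
      (⟹-from (cong (λ t → conf copy t _ _) (sym (focus-[] (bits x)))) (copies x [] []))
      (⟹-to (concatMap-singleton (started x) _)
      (⟹-bind {m = eval (T-clock D) (length x)}
        (subst (λ m → at-pop (reverse x) [ clock (fromℕ D) ] (pushPairs 0b x [])
            ⟹[ eval (T-clock D) m ]
            List.map (λ u → at-pop (reverse x) [] (query u x)) (words ((2 + m) ^ D)))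
          (length-reverse x)
          (Emits.emit (emits (reverse x) D (fromℕ D) (toℕ-fromℕ D) []) (pushPairs 0b x [])))
        (λ u → ⟹-then (step {st′ = read} refl ≈ₜ-refl ≈ₜ-refl ≈ₜ-refl)
          (step {q′ = fromCells (bits (query u x))} refl ≈ₜ-refl (blanksʳ [] blank [])
            (goRight-blank (query u x))))))
    where
    concatMap-singleton : ∀ {A B : Set} (f : A → B) xs → concatMap (λ x → [ f x ]) xs ≡ List.map f xs
    concatMap-singleton f []       = refl
    concatMap-singleton f (x ∷ xs) = cong (f x ∷_) (concatMap-singleton f xs)

  power : ℕ → Polynomial
  power zero    = con 1
  power (suc k) = (con 2 ⊕ var) ⊗ power k

  eval-power : ∀ k n → eval (power k) n ≡ (2 + n) ^ k
  eval-power zero    n = refl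
  eval-power (suc k) n = cong ((2 + n) *_) (eval-power k n)

  -- All guesses for one `x` are equally long, so `N` is started on words of a single length,
  -- polynomial in |x|; a pair takes two cells.
  query-length : Polynomial
  query-length = (power D ⊗ con 2) ⊕ ((var ⊗ con 2) ⊕ con 0)

  T-asker : Polynomial
  T-asker = T-ask ⊕ compose (time N) query-length

  eval-query-length : ∀ ys x → length ys ≡ (2 + length x) ^ D →
                      eval query-length (length x) ≡ length (query ys x)
  eval-query-length ys x eq = begin
    eval (power D) (length x) * 2 + (length x * 2 + 0)
      ≡⟨ cong (λ m → m * 2 + _) (trans (eval-power D (length x)) (sym eq)) ⟩
    length ys * 2 + (length x * 2 + 0)
      ≡⟨ cong (length ys * 2 +_) (length-pushPairs 0b x []) ⟨
    length ys * 2 + length (pushPairs 0b x [])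
      ≡⟨ length-pushPairs 1b ys (pushPairs 0b x []) ⟨
    length (query ys x) ∎
    where open ≡-Reasoning

  asked : Word → List Word
  asked x = words ((2 + length x) ^ D)

  -- From this one matching the accepting, rejecting and total counts of `ask` are all read off as
  -- the counts of `N` accumulated over the queries.
  ends-asker : ∀ x → Pointwise (λ d c → SameVerdict d c)
    (ends asker (eval T-asker (length x)) (initial asker x))
    (concatMap (λ ys → outcomes N (query ys x)) (asked x))
  ends-asker x = subst (λ ds → Pointwise (λ d c → SameVerdict d c) ds
      (concatMap (λ ys → outcomes N (query ys x)) (asked x)))
    (sym (ends-+ {asker} (eval T-ask (length x)) _ (initial asker x)))
    (Pw-concatMap (λ {d} {ys} (p , eq) → simulated d ys p eq)
      (Pw-Allʳ (Pw-mapʳ⁻ (asked x) (ends≈ (asks x))) (length-wordsOver (toList choices) _)))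
    where
    T-N : ℕ
    T-N = eval (compose (time N) query-length) (length x)

    simulated : ∀ d ys → d ≈ started x ys → length ys ≡ (2 + length x) ^ D →
      Pointwise (λ d c → SameVerdict d c) (ends asker T-N d) (outcomes N (query ys x))
    simulated d ys p eq = subst (λ t → Pointwise (λ d c → SameVerdict d c)
        (ends asker T-N d) (ends (machine N) t (initial (machine N) (query ys x))))
      (trans (eval-compose (time N) query-length (length x))
        (cong (eval (time N)) (eval-query-length ys x eq)))
      (Pw.transitive
        (λ {d} {e} {c} q h → SameVerdict-trans {c = d} {e} {c} (≈-verdict q)
          (SameVerdict-sym {c = c} {e} (hosts-verdict h)))
        (ends-simulate ≈-simulation T-N p)
        (Pw.symmetric id (ends-simulate hosts-simulation T-N
          (hosts {ctl = run start} (bits-Shows (query ys x) ∷ blanks-Shows* extraTapes)))))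

  ask : NPTM
  ask = record
    { machine = asker
    ; time    = T-asker
    ; halts   = λ x → SameVerdict-halted (ends-asker x)
                  (AllP.concat⁺ (AllP.map⁺ (All.universal (λ ys → halts N (query ys x)) (asked x))))
    }

-- The language of digits

decode : Word → Word → Word → Word × Word
decode []                 xs ys = xs , ys
decode (_ ∷ [])           xs ys = xs , ys
decode (zero ∷ b ∷ w)     xs ys = decode w (b ∷ xs) ys
decode (suc zero ∷ b ∷ w) xs ys = decode w xs (b ∷ ys)

wordOf paddingOf : Word → Word
wordOf w    = proj₁ (decode w [] [])
paddingOf w = proj₂ (decode w [] [])

isOne : Bit → Bool
isOne zero       = false
isOne (suc zero) = true

digitAt : List Bit → ℕ → Bool
digitAt []       _       = false
digitAt (d ∷ _)  zero    = isOne d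
digitAt (_ ∷ ds) (suc n) = digitAt ds n

-- 0…01u holds iff the digit of weight 2 ^ |u| is 1, so 2 ^ i words of every length
-- m > i hold on account of the digit of weight 2 ^ i.
holds : Word → List Bit → Bool
holds []              ds = false
holds (zero ∷ ys)     ds = holds ys ds
holds (suc zero ∷ ys) ds = digitAt ds (length ys)

-- The tapes are the input, ys, the output of M (ending next to the head, so that it is
-- read from the least significant digit on) and those of M, the first of which receives x.
module Verifying (M : NPTM) (judge : Bool → Bool) where
  open Machine (machine M)

  State : Set
  State = Fin 3 ⊎ Bit ⊎ Q

  pattern readTag   = inj₁ zero
  pattern skip      = inj₁ (suc zero)
  pattern walk      = inj₁ (suc (suc zero))
  pattern readBit t = inj₂ (inj₁ t)
  pattern sim q     = inj₂ (inj₂ q)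

  Act : Set
  Act = Symbol G × Direction

  Step : Set
  Step = Transition State G (4 + extraTapes)

  to : Control State → Vec Act (4 + extraTapes) → Step
  to q as = record { next = q ; actions = as ; emit = nothing }

  answer : Bool → Control State
  answer true  = accept
  answer false = reject

  -- A rejecting path of `M` says nothing about `f x` and rejects whatever `judge` is; only an
  -- accepting path goes on to inspect the recorded output.
  exit : Control Q → Control State
  exit (run q) = run (sim q)
  exit accept  = run skip
  exit reject  = reject

  record-emit : Symbol G → Maybe Bit → Act
  record-emit o nothing  = keep o
  record-emit o (just b) = bit b , goRight

  simStep : Symbol G → Symbol G → Symbol G → Transition Q G (suc extraTapes) → Step
  simStep i y o t = to (exit (next t)) (keep i ∷ keep y ∷ record-emit o (emit t) ∷ actions t)

  isOneₛ : Symbol G → Bool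
  isOneₛ (bit b) = isOne b
  isOneₛ _       = false

  launch : Vec (Symbol G) (4 + extraTapes) → Step
  launch (i ∷ y ∷ o ∷ x ∷ ss) =
    to (run (sim start)) (keep i ∷ (y , goLeft) ∷ keep o ∷ (x , goRight) ∷ Vec.map keep ss)

  δ′ : State → Vec (Symbol G) (4 + extraTapes) → List⁺ Step
  δ′ readTag (bit t ∷ ss) = to (run (readBit t)) ((bit t , goRight) ∷ Vec.map keep ss) ∷ []
  δ′ readTag (i ∷ ss) = launch (i ∷ ss) ∷ []
  δ′ (readBit zero) (bit b ∷ y ∷ o ∷ x ∷ ss) = to (run readTag)
    ((bit b , goRight) ∷ keep y ∷ keep o ∷ (bit b , goLeft) ∷ Vec.map keep ss) ∷ []
  δ′ (readBit (suc zero)) (bit b ∷ y ∷ ss) = to (run readTag)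
    ((bit b , goRight) ∷ (bit b , goRight) ∷ Vec.map keep ss) ∷ []
  -- A tag without a bit ends the input, since words of odd length decode as well.
  δ′ (readBit _) (i ∷ ss) = launch (i ∷ ss) ∷ []
  δ′ (sim q) (i ∷ y ∷ o ∷ ss) = List⁺.map (simStep i y o) (δ q ss)
  -- Leading zeros of `ys` are passed over. From the first 1 on, `walk` moves both heads in step, so
  -- the end of `ys` finds the other head on the digit of weight 2 ^ |u|.
  δ′ skip (i ∷ bit zero ∷ ss) =
    to (run skip) (keep i ∷ (bit zero , goLeft) ∷ Vec.map keep ss) ∷ []
  δ′ skip (i ∷ bit (suc zero) ∷ o ∷ ss) = to (run walk)
    (keep i ∷ (bit (suc zero) , goLeft) ∷ (o , goLeft) ∷ Vec.map keep ss) ∷ []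
  δ′ skip (i ∷ y ∷ ss) = to (answer (judge false)) (Vec.map keep (i ∷ y ∷ ss)) ∷ []
  δ′ walk (i ∷ bit b ∷ o ∷ ss) =
    to (run walk) (keep i ∷ (bit b , goLeft) ∷ (o , goLeft) ∷ Vec.map keep ss) ∷ []
  δ′ walk (i ∷ y ∷ o ∷ ss) =
    to (answer (judge (isOneₛ o))) (Vec.map keep (i ∷ y ∷ o ∷ ss)) ∷ []

  verifier : Machine
  verifier = record
    { Q          = State
    ; Q-finite   = finite-⊎ (finite-Fin 3) (finite-⊎ (finite-Fin 2) Q-finite)
    ; G          = G
    ; G-finite   = G-finite
    ; extraTapes = 3 + extraTapes
    ; start      = readTag
    ; δ          = δ′
    }

  step : ∀ {st ctl ts w as} {ts′ : Vec (Tape G) (4 + extraTapes)} →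
         δ′ st (Vec.map head ts) ≡ to ctl as ∷ [] →
         Vec.zipWith act as ts ≈* ts′ →
         _⟹[_]_ {verifier} (config (run st) ts w) 1 [ config ctl ts′ w ]
  step {st} {ctl} {ts} {w} {as} {ts′} eq p = ⟹-step
    (subst (λ us → Pointwise (_≈_ {verifier}) (List.map (apply verifier ts w) (toList us))
                     [ config ctl ts′ w ])
      (sym eq) (same p ∷ []))

  kept : ∀ {k} {ts : Vec (Tape G) k} → Vec.zipWith act (Vec.map keep (Vec.map head ts)) ts ≈* ts
  kept = ≈*-reflexive (act-keep _)

  none : Vec (Tape G) extraTapes
  none = Vec.replicate extraTapes (fromCells [])

  launched : Word × Word → Tape G → Config verifier
  launched (xs , ys) i = config (run (sim start))
    (i ∷ focusˡ (bits ys) [ blank ] ∷ tape [] blank [] ∷ fromCells (bits xs) ∷ none) []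

  launches : ∀ xs ys → Vec.zipWith (act {G}) ((blank , goLeft) ∷ keep blank ∷ (blank , goRight) ∷ Vec.map keep (Vec.map head none))
    (tape (bits ys) blank [] ∷ tape [] blank [] ∷ tape [] blank (bits xs) ∷ none) ≈*
    (focusˡ (bits ys) [ blank ] ∷ tape [] blank [] ∷ fromCells (bits xs) ∷ none)
  launches xs ys = ≡⇒≈ₜ (goLeft-focus (bits ys) blank []) ∷ ≈ₜ-refl ∷ goRight-blank xs ∷ kept

  -- The input tape is existential: from the launch on it is neither moved nor consulted.
  decodes : ∀ w l xs ys → Σ[ i ∈ Tape G ]
    config (run readTag)
      (focus l (bits w) ∷ tape (bits ys) blank [] ∷ tape [] blank [] ∷ tape [] blank (bits xs) ∷ none) []
      ⟹[ length w + 1 ] [ launched (decode w xs ys) i ]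
  decodes []       l xs ys = _ , step refl (≈ₜ-refl ∷ launches xs ys)
  decodes (zero ∷ []) l xs ys = _ ,
    ⟹-then (step refl (≈ₜ-refl ∷ kept)) (step {st = readBit zero} refl (≈ₜ-refl ∷ launches xs ys))
  decodes (suc zero ∷ []) l xs ys = _ ,
    ⟹-then (step refl (≈ₜ-refl ∷ kept)) (step {st = readBit 1b} refl (≈ₜ-refl ∷ launches xs ys))
  decodes (zero ∷ b ∷ w) l xs ys =
    let i , r = decodes w (bit b ∷ bit zero ∷ l) (b ∷ xs) ys in i ,
    ⟹-then (step {st = readTag} refl (≈ₜ-refl ∷ kept))
    (⟹-then (step {st = readBit zero} refl
        (≡⇒≈ₜ (goRight-focus (bit zero ∷ l) (bit b) (bits w)) ∷ ≈ₜ-refl ∷ ≈ₜ-refl ∷ ≈ₜ-refl ∷ kept))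
      r)
  decodes (suc zero ∷ b ∷ w) l xs ys =
    let i , r = decodes w (bit b ∷ bit 1b ∷ l) xs (b ∷ ys) in i ,
    ⟹-then (step {st = readTag} refl (≈ₜ-refl ∷ kept))
    (⟹-then (step {st = readBit 1b} refl
        (≡⇒≈ₜ (goRight-focus (bit 1b ∷ l) (bit b) (bits w)) ∷ ≈ₜ-refl ∷ kept))
      r)

  Decides : Config verifier → ℕ → Control State → Set
  Decides c n ctl = Σ[ d ∈ Config verifier ] (c ⟹[ n ] [ d ] × control d ≡ ctl)

  -- The digit head may run off `ds`; the blanks beyond count as digit 0, in agreement with
  -- `digitAt`.
  walks : ∀ ys r ds r′ {i w} {ts : Vec (Tape G) (suc extraTapes)} →
    Decides (config (run walk) (i ∷ focusˡ (bits ys) r ∷ focusˡ (bits ds) r′ ∷ ts) w)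
            (suc (length ys)) (answer (judge (digitAt ds (length ys))))
  walks []       r []       r′ = _ , step {st = walk} refl kept , refl
  walks []       r (d ∷ ds) r′ = _ , step {st = walk} refl kept , refl
  walks (b ∷ ys) r []       r′ =
    let d , p , eq = walks ys (bit b ∷ r) [] (blank ∷ r′) in d ,
    ⟹-then (step {st = walk} refl
      (≈ₜ-refl ∷ ≡⇒≈ₜ (goLeft-focus (bits ys) (bit b) r) ∷ ≈ₜ-refl ∷ kept)) p , eq
  walks (b ∷ ys) r (d′ ∷ ds) r′ =
    let d , p , eq = walks ys (bit b ∷ r) ds (bit d′ ∷ r′) in d ,
    ⟹-then (step {st = walk} refl
      (≈ₜ-refl ∷ ≡⇒≈ₜ (goLeft-focus (bits ys) (bit b) r) ∷
       ≡⇒≈ₜ (goLeft-focus (bits ds) (bit d′) r′) ∷ kept)) p , eq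

  checks : ∀ ys r ds {i w} {ts : Vec (Tape G) (suc extraTapes)} →
    Decides (config (run skip) (i ∷ focusˡ (bits ys) r ∷ tape (bits ds) blank [] ∷ ts) w)
            (suc (length ys)) (answer (judge (holds ys ds)))
  checks []              r ds = _ , step {st = skip} refl kept , refl
  checks (zero ∷ ys)     r ds =
    let d , p , eq = checks ys (bit zero ∷ r) ds in d ,
    ⟹-then (step {st = skip} refl
      (≈ₜ-refl ∷ ≡⇒≈ₜ (goLeft-focus (bits ys) (bit zero) r) ∷ kept)) p , eq
  checks (suc zero ∷ ys) r ds =
    let d , p , eq = walks ys (bit 1b ∷ r) ds (blank ∷ []) in d ,
    ⟹-then (step {st = skip} refl
      (≈ₜ-refl ∷ ≡⇒≈ₜ (goLeft-focus (bits ys) (bit 1b) r) ∷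
       ≡⇒≈ₜ (goLeft-focus (bits ds) blank []) ∷ kept)) p , eq

  data Hosts (ys : Word) : Config (machine M) → Config verifier → Set where
    hosts : ∀ {ctl i o out w} {ts us : Vec (Tape G) (suc extraTapes)} →
            o ≡ tape (bits (reverse out)) blank [] → ts ≈* us →
            Hosts ys (config ctl us out)
                     (config (exit ctl) (i ∷ focusˡ (bits ys) [ blank ] ∷ o ∷ ts) w)

  hosts-successors : ∀ {ys q us out d} → Hosts ys (config (run q) us out) d →
    Pointwise (Hosts ys) (successors (machine M) (config (run q) us out)) (successors verifier d)
  hosts-successors {ys} {q} {us} {out} (hosts {i = i} {o} {ts = ts} refl p)
    rewrite trans (sym (VecP.map-id (Vec.map head ts))) (View.heads-Shows* idView p) =
    subst (Pointwise (Hosts ys) _) (map-∘ (toList (δ q (Vec.map head us))))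
      (Pw-map₂ (λ t → hosts (recorded (emit t))
        (subst (λ as → Vec.zipWith act as ts ≈* Vec.zipWith act (actions t) us) (VecP.map-id (actions t))
          (View.act-Shows* idView (actions t) p))) (toList (δ q (Vec.map head us))))
    where
    recorded : ∀ e → act (record-emit blank e) (tape (bits (reverse out)) blank []) ≡
                     tape (bits (reverse (out ++ List.fromMaybe e))) blank []
    recorded nothing  = cong (λ w → tape (bits (reverse w)) blank []) (sym (++-identityʳ out))
    recorded (just b) = cong (λ w → tape (bits w) blank []) (sym (reverse-++ out [ b ]))

  record Judged (ys : Word) (c : Config (machine M)) (d : Config verifier) : Set where
    constructor judging
    field
      halted  : Halted d
      verdict : accepting d ≡ accepting c ∧ judge (holds ys (reverse (output c)))

  answered : ∀ b d → control d ≡ answer b → Halted {verifier} d × accepting d ≡ b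
  answered true  (config _ _ _) refl = _ , refl
  answered false (config _ _ _) refl = _ , refl

  ≈-control : ∀ {c d : Config verifier} → c ≈ d → control c ≡ control d
  ≈-control (same _) = refl

  judged : ∀ {ys c d} → Hosts ys c d → Halted c →
           Pointwise (Judged ys) [ c ] (ends verifier (suc (length ys)) d)
  judged {ys} {config accept us out} (hosts {i = i} {w = w} {ts} refl p) _
    with checks ys [ blank ] (reverse out) {i} {w} {ts}
  ... | d , reach r , eq = Pw.transitive
      (λ {c} {d} {e} (acc , eq) d≈ → let h , eq′ = answered _ e (trans (≈-control d≈) eq) in
        judging h (trans eq′ (cong (_∧ judge (holds ys (reverse (output c)))) (sym acc))))
      (_∷_ {R = λ c d → accepting c ≡ true × control d ≡ answer (judge (holds ys (reverse (output c))))}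
        (refl , eq) [])
      (Pw.symmetric id r)
  judged {ys} {config reject us out} {d} (hosts {ctl = reject} eq p) _ =
    subst (Pointwise (Judged ys) _)
      (sym (ends-halted (suc (length ys)) {config reject _ _} _)) (judging _ refl ∷ [])

  Pw-halted : ∀ {cs ds ys} → Pointwise (Judged ys) cs ds → All Halted ds
  Pw-halted []             = []
  Pw-halted (judging h _ ∷ js) = h ∷ Pw-halted js

  -- The paths of `M` halt at different times, so their checks start at different times. On a path
  -- that halts early the check ends early and `ends-stable` absorbs the rest, so one bound suits
  -- all paths.
  judges : ∀ n {ys c d} → Hosts ys c d → All Halted (ends (machine M) n c) →
           Pointwise (Judged ys) (ends (machine M) n c) (ends verifier (n + suc (length ys)) d)
  judges-halted : ∀ n {ys c d} → Hosts ys c d → Halted c →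
           Pointwise (Judged ys) (ends (machine M) n c) (ends verifier (n + suc (length ys)) d)
  judges zero r (h ∷ []) = judged r h
  judges (suc n) {ys} {c@(config (run q) us out)} {d@(config _ _ _)} r@(hosts _ _) hs =
    Pw-concatMap (λ (r , hs) → judges n r hs)
      (Pw-Allˡ (hosts-successors r) (All-concatMap⁻ (successors (machine M) c) hs))
  judges (suc n) {c = config accept _ _} r hs = judges-halted (suc n) r _
  judges (suc n) {c = config reject _ _} r hs = judges-halted (suc n) r _
  judges-halted n {ys} {c} {d} r h = subst₂ (Pointwise (Judged ys))
    (sym (ends-halted n {c} h))
    (sym (ends-stable {m = suc (length ys)} (Pw-halted (judged r h)) (m≤n+m _ n)))
    (judged r h)

  -- Neither part decoded from `w` is longer than `w`, so by monotonicity the times of `M` and of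
  -- the check may be taken at |w|.
  T-verifier : Polynomial
  T-verifier = (var ⊕ con 1) ⊕ (time M ⊕ (con 1 ⊕ var))

  length-decode : ∀ w xs ys → length (proj₁ (decode w xs ys)) ≤ length w + length xs ×
                              length (proj₂ (decode w xs ys)) ≤ length w + length ys
  length-decode []           xs ys = ≤-refl , ≤-refl
  length-decode (_ ∷ [])     xs ys = m≤n⇒m≤1+n ≤-refl , m≤n⇒m≤1+n ≤-refl
  length-decode (zero ∷ b ∷ w) xs ys with length-decode w (b ∷ xs) ys
  ... | p , q rewrite +-suc (length w) (length xs) =
    m≤n⇒m≤1+n p , m≤n⇒m≤1+n (m≤n⇒m≤1+n q)
  length-decode (suc zero ∷ b ∷ w) xs ys with length-decode w xs (b ∷ ys)
  ... | p , q rewrite +-suc (length w) (length ys) =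
    m≤n⇒m≤1+n (m≤n⇒m≤1+n p) , m≤n⇒m≤1+n q

  ends-verifier : ∀ w → Pointwise (Judged (paddingOf w)) (outcomes M (wordOf w))
    (ends verifier (eval T-verifier (length w)) (initial verifier w))
  ends-verifier w = Pw.transitive judged-≈ judged-T (Pw.symmetric id (ends≈ run-all))
    where
    x  = wordOf w
    ys = paddingOf w
    T₁ T₂ : ℕ
    T₁ = eval (time M) (length x) + suc (length ys)
    T₂ = eval (time M) (length w) + suc (length w)

    i : Tape G
    i = proj₁ (decodes w [] [] [])

    judged-≈ : ∀ {c d e} → Judged ys c d → e ≈ d → Judged ys c e
    judged-≈ {d = d} {e} (judging h eq) p with ≈-verdict p
    ... | a , r = judging (subst T (sym (cong₂ _∨_ a r)) h) (trans a eq)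

    run-all : initial verifier w ⟹[ length w + 1 + T₂ ] ends verifier T₂ (launched (decode w [] []) i)
    run-all = ⟹-from (cong (λ t → config _ (t ∷ _) []) (sym (focus-[] (bits w))))
      (⟹-then (proj₂ (decodes w [] [] [])) (reach (Pw.refl ≈-refl)))

    T₁≤T₂ : T₁ ≤ T₂
    T₁≤T₂ with length-decode w [] []
    ... | p , q rewrite +-identityʳ (length w) = +-mono-≤ (eval-mono (time M) p) (s≤s q)

    judged-T : Pointwise (Judged ys) (outcomes M x) (ends verifier T₂ (launched (decode w [] []) i))
    judged-T = subst (Pointwise (Judged ys) (outcomes M x))
      (sym (ends-stable (Pw-halted judged-T₁) T₁≤T₂)) judged-T₁
      where
      judged-T₁ : Pointwise (Judged ys) (outcomes M x)
                    (ends verifier T₁ (launched (decode w [] []) i))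
      judged-T₁ = judges (eval (time M) (length x)) (hosts {ctl = run start} refl ≈*-refl) (halts M x)

  verify : NPTM
  verify = record
    { machine = verifier
    ; time    = T-verifier
    ; halts   = λ w → Pw-halted (ends-verifier w)
    }

-- Asking for all digits along one path

inverse : Direction → Direction
inverse goLeft  = goRight
inverse stay    = stay
inverse goRight = goLeft

-- A step writes before it moves, so undoing it takes two: move back, rewriting the symbol scanned
-- meanwhile, and only then restore the old symbol. These are the states `undo₁` and `undo₂` of
-- `Looping`.
act-undo : {G : Set} → ∀ d (s : Symbol G) t →
  act (head t , stay) (move (inverse d) (act (s , d) t)) ≈ₜ t
act-undo goLeft  s (tape []      h r)       = blanksˡ [] h r
act-undo goLeft  s (tape (_ ∷ _) h r)       = ≈ₜ-refl
act-undo stay    s (tape l       h r)       = ≈ₜ-refl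
act-undo goRight s (tape l       h [])      = blanksʳ l h []
act-undo goRight s (tape l       h (_ ∷ _)) = ≈ₜ-refl

Shows-≈ : {G H : Set} {look : Symbol G → Symbol H} {t : Tape G} {u v : Tape H} →
          Shows look t u → u ≈ₜ v → Shows look t v
Shows-≈ p q = record
  { lefts  = λ n → trans (lefts p n) (lefts q n)
  ; here   = trans (here p) (here q)
  ; rights = λ n → trans (rights p n) (rights q n)
  }

-- A final tag without its bit counts as a pair, since the leaf states fork on the tag and take the
-- missing bit for a blank cell.
lead : Word → ℕ
lead []                 = 0
lead (zero ∷ _)         = 0
lead (suc zero ∷ [])    = 1
lead (suc zero ∷ _ ∷ w) = suc (lead w)

-- Counting paths regardless of their verdicts

module _ {M : Machine} where

  record Paths (c : Config M) (n k : ℕ) : Set where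
    constructor paths
    field
      all-halted : All Halted (ends M n c)
      count      : length (ends M n c) ≡ k

  paths-mono : ∀ {c m n k} → m ≤ n → Paths c m k → Paths c n k
  paths-mono {c} {m} m≤n (paths hs eq) =
    paths (halted-mono {m = m} hs m≤n) (trans (cong length (ends-stable {m = m} hs m≤n)) eq)

  paths-halted : ∀ {c} n → Halted c → Paths c n 1
  paths-halted {c} n h = paths (subst (All Halted) (sym eq) (h ∷ [])) (cong length eq)
    where
    eq : ends M n c ≡ [ c ]
    eq = ends-halted n {c} h

  ⟹-continue : ∀ {m c ds} → c ⟹[ m ] ds → ∀ n → c ⟹[ m + n ] concatMap (ends M n) ds
  ⟹-continue {m} {c} {ds} (reach r) n =
    reach (subst (λ es → Pointwise _≈_ es (concatMap (ends M n) ds)) (sym (ends-+ m n c))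
      (Pw-concatMap (ends-simulate ≈-simulation n) r))

  ⟹-paths : ∀ {c n es} → c ⟹[ n ] es → All Halted es → Paths c n (length es)
  ⟹-paths (reach r) hs =
    paths (SameVerdict-halted (Pw.map ≈-verdict r) hs) (Pw.Pointwise-length r)

  paths-then : ∀ {c d m n k} → c ⟹[ m ] [ d ] → Paths d n k → Paths c (m + n) k
  paths-then {c} {d} {m} {n} r (paths hs refl) =
    subst (λ es → Paths c (m + n) (length es)) (++-identityʳ (ends M n d))
      (⟹-paths (⟹-continue r n) (subst (All Halted) (sym (++-identityʳ _)) hs))

  paths-fork : ∀ {c d e m n k l} → c ⟹[ m ] (d ∷ e ∷ []) →
               Paths d n k → Paths e n l → Paths c (m + n) (k + l)
  paths-fork {c} {d} {e} {m} {n} {k} {l} r (paths hs eq) (paths hs′ eq′) =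
    subst (Paths c (m + n)) count
      (⟹-paths (⟹-continue r n)
        (AllP.++⁺ hs (subst (All Halted) (sym (++-identityʳ _)) hs′)))
    where
    open ≡-Reasoning
    count : length (ends M n d ++ ends M n e ++ []) ≡ k + l
    count = begin
      length (ends M n d ++ ends M n e ++ [])  ≡⟨ length-++ (ends M n d) ⟩
      length (ends M n d) + length (ends M n e ++ [])
        ≡⟨ cong₂ _+_ eq (trans (cong length (++-identityʳ (ends M n e))) eq′) ⟩
      k + l ∎

module DeterministicRuns (M : Machine) (det : Deterministic M) where
  open Machine M

  successors-det : ∀ q us out → successors M (config (run q) us out) ≡
    [ apply M us out (List⁺.head (δ q (Vec.map head us))) ]
  successors-det q us out with δ q (Vec.map head us) | det q (Vec.map head us)
  ... | t ∷ [] | _ = refl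

  ends-suc-det : ∀ n q us out → ends M (suc n) (config (run q) us out) ≡
    ends M n (apply M us out (List⁺.head (δ q (Vec.map head us))))
  ends-suc-det n q us out =
    trans (cong (concatMap (ends M n)) (successors-det q us out)) (++-identityʳ _)

  ends-det : ∀ n c → Σ[ d ∈ Config M ] ends M n c ≡ [ d ]
  ends-det zero    c = c , refl
  ends-det (suc n) c@(config accept _ _) = c , ends-halted (suc n) {c} _
  ends-det (suc n) c@(config reject _ _) = c , ends-halted (suc n) {c} _
  ends-det (suc n) (config (run q) us out) =
    let d , eq = ends-det n (apply M us out (List⁺.head (δ q (Vec.map head us))))
    in d , trans (ends-suc-det n q us out) eq

count-single : {A : Set} {p : A → Bool} {xs : List A} {x : A} → xs ≡ [ x ] →
  p x ≡ true ⇔ 0 < length (filterᵇ p xs)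
count-single {p = p} {x = x} refl with p x
... | true  = mk⇔ (λ _ → s≤s z≤n) (λ _ → refl)
... | false = mk⇔ (λ ()) (λ ())

single-verdict : ∀ M L → M Accepts L → ∀ x {d} → outcomes M x ≡ [ d ] → accepting d ≡ L x
single-verdict M L acc x eq =
  ⇔→≡ (⇔-sym (acc x) ⇔-∘ count-single eq)

accepts-single : ∀ M L → (∀ x → Σ[ d ∈ Config (machine M) ] (outcomes M x ≡ [ d ] × accepting d ≡ L x)) →
  M Accepts L
accepts-single M L single x with single x
... | d , eq , v rewrite sym v = count-single eq

-- After each query the decider is run backwards along a history tape, which clears
-- its tapes for the next query.  A positive answer forks off a tree with 2 ^ i
-- leaves, where i + 1 is the number of leading pairs with tag 1.
module Looping (M : NPTM) (det : Deterministic (machine M)) where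
  open Machine (machine M)
  open DeterministicRuns (machine M) det

  -- By determinism the state and the scanned symbols before a step determine the transition, so
  -- they are all that is needed to undo it.
  Entry Letter State : Set
  Entry  = Q × Vec (Symbol G) (suc extraTapes)
  Letter = Entry ⊎ G
  State  = Fin 4 ⊎ (Fin 3 × Bool) ⊎ Q

  pattern begin₀  = inj₁ zero
  pattern drop₁   = inj₁ (suc zero)
  pattern leaf₀   = inj₁ (suc (suc zero))
  pattern leaf₁   = inj₁ (suc (suc (suc zero)))
  pattern undo₀ b = inj₂ (inj₁ (zero , b))
  pattern undo₁ b = inj₂ (inj₁ (suc zero , b))
  pattern undo₂ b = inj₂ (inj₁ (suc (suc zero) , b))
  pattern sim q   = inj₂ (inj₂ q)
  pattern entry e = aux (inj₁ e)

  open View (rightView {Entry} {G})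

  Act : Set
  Act = Symbol Letter × Direction

  Step : Set
  Step = Transition State Letter (2 + extraTapes)

  to : Control State → Vec Act (2 + extraTapes) → Step
  to q as = record { next = q ; actions = as ; emit = nothing }

  exit : Control Q → Control State
  exit (run q) = run (sim q)
  exit accept  = run (undo₀ true)
  exit reject  = run (undo₀ false)

  transition : Entry → Transition Q G (suc extraTapes)
  transition (q , ss) = List⁺.head (δ q ss)

  moves : Entry → Vec (Symbol G × Direction) (suc extraTapes)
  moves e = actions (transition e)

  forward : Entry → Step
  forward e = to (exit (next (transition e)))
    (lift (Vec.head (moves e)) ∷ (entry e , goRight) ∷ Vec.map lift (Vec.tail (moves e)))

  retract : Symbol Letter → Symbol G × Direction → Act
  retract s (_ , d) = s , inverse d

  tagged : {A : Set} → Symbol G → A → A → A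
  tagged (bit (suc zero)) x y = x
  tagged _                x y = y

  δ′ : State → Vec (Symbol Letter) (2 + extraTapes) → List⁺ Step
  δ′ begin₀ (s ∷ ss) = tagged (look s)
    (to (run (sim start)) (Vec.map keep (s ∷ ss)) ∷ [])
    -- When no query is left the main path ends here; it is the one that `tot` subtracts.
    (to accept (Vec.map keep (s ∷ ss)) ∷ [])
  δ′ drop₁ (s ∷ ss) = to (run begin₀) ((blank , goRight) ∷ Vec.map keep ss) ∷ []
  -- Each remaining pair with tag 1 doubles the number of paths.
  δ′ leaf₀ (s ∷ ss) = tagged (look s)
    (to (run leaf₁) ((s , goRight) ∷ Vec.map keep ss) ∷
     to (run leaf₁) ((s , goRight) ∷ Vec.map keep ss) ∷ [])
    (to accept (Vec.map keep (s ∷ ss)) ∷ [])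
  δ′ leaf₁ (s ∷ ss) = to (run leaf₀) ((s , goRight) ∷ Vec.map keep ss) ∷ []
  δ′ (undo₀ b) (s ∷ h ∷ ss) =
    to (run (undo₁ b)) (keep s ∷ (h , goLeft) ∷ Vec.map keep ss) ∷ []
  δ′ (undo₁ b) (s ∷ entry e ∷ ss) = to (run (undo₂ b))
    (retract s (Vec.head (moves e)) ∷ keep (entry e) ∷
     Vec.zipWith retract ss (Vec.tail (moves e))) ∷ []
  -- A cell without an entry is the bottom of the history: the tapes are as before the query. One
  -- path now becomes the tree of leaves, the other goes on to the next query.
  δ′ (undo₁ true) (s ∷ h ∷ ss) =
    to (run leaf₁) ((s , goRight) ∷ (h , goRight) ∷ Vec.map keep ss) ∷
    to (run drop₁) ((blank , goRight) ∷ (h , goRight) ∷ Vec.map keep ss) ∷ []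
  δ′ (undo₁ false) (s ∷ h ∷ ss) =
    to (run drop₁) ((blank , goRight) ∷ (h , goRight) ∷ Vec.map keep ss) ∷ []
  δ′ (undo₂ b) (s ∷ entry (_ , us) ∷ ss) = to (run (undo₀ b))
    (keep (put (Vec.head us)) ∷ keep blank ∷ Vec.map (keep ∘ put) (Vec.tail us)) ∷ []
  -- Never reached: `undo₁` enters this state only on a cell holding an entry.
  δ′ (undo₂ b) ss = to reject (Vec.map keep ss) ∷ []
  δ′ (sim q) (s ∷ h ∷ ss) = forward (q , Vec.map look (s ∷ ss)) ∷ []

  looper : Machine
  looper = record
    { Q          = State
    ; Q-finite   = finite-⊎ (finite-Fin 4) (finite-⊎
        (finite-× (finite-Fin 3) (finite-↔ (↔-sym 2↔Bool) (finite-Fin 2))) Q-finite)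
    ; G          = Letter
    ; G-finite   = finite-⊎
        (finite-× Q-finite (finite-Vec (finite-Symbol G-finite) (suc extraTapes))) G-finite
    ; extraTapes = suc extraTapes
    ; start      = begin₀
    ; δ          = δ′
    }

  steps : ∀ {st ts w ss} →
          δ′ st (Vec.map head ts) ≡ ss →
          _⟹[_]_ {looper} (config (run st) ts w) 1 (List.map (apply looper ts w) (toList ss))
  steps refl = ⟹-step (Pw.refl ≈-refl)

  kept : ∀ {k} (ts : Vec (Tape Letter) k) →
         Vec.zipWith act (Vec.map keep (Vec.map head ts)) ts ≈* ts
  kept ts = ≈*-reflexive (act-keep ts)

  step : ∀ {st ctl ts v as} {ts′ : Vec (Tape Letter) (2 + extraTapes)} →
         δ′ st (Vec.map head ts) ≡ to ctl as ∷ [] →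
         Vec.zipWith act as ts ≈* ts′ →
         _⟹[_]_ {looper} (config (run st) ts v) 1 [ config ctl ts′ [] ]
  step {ts = ts} {v} eq p = ⟹-≈′ (same p) (steps {ts = ts} {w = v} eq)
    where
    ⟹-≈′ : ∀ {c d e} → d ≈ e → _⟹[_]_ {looper} c 1 [ d ] → c ⟹[ 1 ] [ e ]
    ⟹-≈′ p (reach r) = reach (Pw.transitive ≈-trans r (p ∷ []))

  conf : Control State → Tape Letter → Tape Letter → Vec (Tape Letter) extraTapes → Config looper
  conf ctl t h ts = config ctl (t ∷ h ∷ ts) []

  history : List (Symbol Letter) → Tape Letter
  history es = tape es blank []

  retract-Shows : ∀ {t u} a → Shows look t (act a u) →
    Shows look (act (keep (put (head u))) (act (retract (head t) a) t)) u
  retract-Shows {t} {u} (s , d) sh = Shows-≈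
    (act-Shows stay (look-put (head u)) (act-Shows {t} {act (s , d) u} (inverse d) (here sh) sh))
    (act-undo d s u)

  retract-Shows* : ∀ {k} as {ts : Vec (Tape Letter) k} us → ts Shows* Vec.zipWith act as us →
    Vec.zipWith act (Vec.map (keep ∘ put) (Vec.map head us))
      (Vec.zipWith act (Vec.zipWith retract (Vec.map head ts) as) ts) Shows* us
  retract-Shows* []       []       []         = []
  retract-Shows* (a ∷ as) (u ∷ us) (sh ∷ shs) = retract-Shows a sh ∷ retract-Shows* as us shs

  record Undone (ctl : Control State) (n : ℕ) (c : Config looper) (es : List (Symbol Letter))
                (us : Vec (Tape G) (suc extraTapes)) : Set where
    field
      {duration} : ℕ
      bounded    : duration ≤ n
      {tape₀}    : Tape Letter
      {tapes₊}   : Vec (Tape Letter) extraTapes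
      seen       : (tape₀ ∷ tapes₊) Shows* us
      arrives    : c ⟹[ duration ] [ conf ctl tape₀ (history es) tapes₊ ]

  undoes : ∀ {b t ts u us es} e → proj₂ e ≡ Vec.map head (u ∷ us) →
    (t ∷ ts) Shows* Vec.zipWith act (moves e) (u ∷ us) →
    Undone (run (undo₀ b)) 3 (conf (run (undo₀ b)) t (history (entry e ∷ es)) ts) es (u ∷ us)
  undoes {b} {t} {ts} {u} {us} {es} e@(q , .(Vec.map head (u ∷ us))) refl sh with moves e in eq
  undoes {b} {t} {ts} {u} {us} {es} e@(q , .(Vec.map head (u ∷ us))) refl (sh ∷ shs) | a ∷ as = record
    { bounded = ≤-refl
    ; seen = retract-Shows a sh ∷ retract-Shows* as us shs
    ; arrives = ⟹-then (step {st = undo₀ b} refl (≈ₜ-refl ∷ ≈ₜ-refl ∷ kept ts))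
        (⟹-then (step {st = undo₁ b} (cong (λ as → to (run (undo₂ b))
            (retract (head t) (Vec.head as) ∷ keep (entry e) ∷
              Vec.zipWith retract (Vec.map head ts) (Vec.tail as)) ∷ []) eq) ≈*-refl)
          (step {st = undo₂ b} refl (≈ₜ-refl ∷ blanksʳ es blank [] ∷ ≈*-refl)))
    }

  forward-Shows : ∀ {t ts u us} (as : Vec _ (suc extraTapes)) → (t ∷ ts) Shows* (u ∷ us) →
    (act (lift (Vec.head as)) t ∷ Vec.zipWith act (Vec.map lift (Vec.tail as)) ts)
      Shows* Vec.zipWith act as (u ∷ us)
  forward-Shows (a ∷ as) sh = act-Shows* (a ∷ as) sh

  -- A step of the decider costs one step forward and the three of `undoes`, whence the factor 4.
  -- The induction hypothesis contains the way back: from the next configuration the run reaches its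
  -- verdict and returns with the present entry on top of the history.
  undone : ∀ n {q us out d} → All Halted (ends (machine M) n (config (run q) us out)) →
    ends (machine M) n (config (run q) us out) ≡ [ d ] → ∀ {t ts es} → (t ∷ ts) Shows* us →
    Undone (run (undo₀ (accepting d))) (4 * n) (conf (run (sim q)) t (history es) ts) es us
  undone-from : ∀ n ctl {us out d} → All Halted (ends (machine M) n (config ctl us out)) →
    ends (machine M) n (config ctl us out) ≡ [ d ] → ∀ {t ts es} → (t ∷ ts) Shows* us →
    Undone (run (undo₀ (accepting d))) (4 * n) (conf (exit ctl) t (history es) ts) es us
  undone zero (() ∷ _)
  undone (suc n) {q} {u ∷ us} {out} {d} hs eq {t} {ts} {es} sh = record
    { bounded = ≤-trans (s≤s (+-mono-≤ (Undone.bounded forth) (Undone.bounded back)))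
                        (≤-reflexive (trans (cong suc (+-comm (4 * n) 3)) (sym (*-suc 4 n))))
    ; seen    = Undone.seen back
    ; arrives = ⟹-then forwards (⟹-then (Undone.arrives forth) (Undone.arrives back))
    }
    where
    e : Entry
    e = q , Vec.map head (u ∷ us)

    next-ends = ends-suc-det n q (u ∷ us) out

    forwards : conf (run (sim q)) t (history es) ts ⟹[ 1 ]
      [ conf (exit (next (transition e))) (act (lift (Vec.head (moves e))) t)
             (history (entry e ∷ es)) (Vec.zipWith act (Vec.map lift (Vec.tail (moves e))) ts) ]
    forwards = step {st = sim q} (cong (λ gs → forward (q , gs) ∷ []) (heads-Shows* sh)) ≈*-refl

    forth = undone-from n (next (transition e)) (subst (All Halted) next-ends hs)
              (trans (sym next-ends) eq) {es = entry e ∷ es} (forward-Shows (moves e) sh)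
    back = undoes {accepting d} {es = es} e refl (Undone.seen forth)
  undone-from n (run q) hs eq sh = undone n hs eq sh
  undone-from n accept {us} {out} {d} hs eq sh
    with refl ← trans (sym (ends-halted n {config accept us out} _)) eq =
    record { bounded = z≤n ; seen = sh ; arrives = ⟹-refl ≈-refl }
  undone-from n reject {us} {out} {d} hs eq sh
    with refl ← trans (sym (ends-halted n {config reject us out} _)) eq =
    record { bounded = z≤n ; seen = sh ; arrives = ⟹-refl ≈-refl }

  none : Vec (Tape G) extraTapes
  none = Vec.replicate extraTapes (fromCells [])

  skips : ∀ {t s} l v → look s ≡ head (focus l (bits v)) → Shows look t (focus l (bits v)) →
    Σ[ l′ ∈ List (Symbol G) ] Shows look (act (s , goRight) t) (focus l′ (bits (List.drop 1 v)))
  skips l []      eq sh = _ , act-Shows goRight eq sh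
  skips l (b ∷ v) eq sh = _ , subst (Shows look _) (goRight-focus l (bit b) (bits v)) (act-Shows goRight eq sh)

  module _ {A : Set} {x y : A} where
    begins-1 : ∀ {t : Tape Letter} {l v} → Shows look t (focus l (bits (1b ∷ v))) →
               tagged (look (head t)) x y ≡ x
    begins-1 sh rewrite here sh = refl

    begins-0 : ∀ {t : Tape Letter} {l v} → Shows look t (focus l (bits (0b ∷ v))) →
               tagged (look (head t)) x y ≡ y
    begins-0 sh rewrite here sh = refl

    ends-here : ∀ {t : Tape Letter} {l} → Shows look t (focus l []) →
               tagged (look (head t)) x y ≡ y
    ends-here sh rewrite here sh = refl

  leaf₁-paths : ∀ v l {t h ts n k} → Shows look t (focus l (bits v)) →
    (∀ {t h ts} l′ → Shows look t (focus l′ (bits (List.drop 1 v))) →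
      Paths (conf (run leaf₀) t h ts) n k) →
    Paths (conf (run leaf₁) t h ts) (1 + n) k
  leaf₁-paths v l {ts = ts} sh rest =
    let l′ , sh′ = skips l v (here sh) sh
    in paths-then (step {st = leaf₁} refl (≈ₜ-refl ∷ ≈ₜ-refl ∷ kept ts)) (rest l′ sh′)

  leaves-fork : ∀ v l {t h ts n k} → Shows look t (focus l (bits (1b ∷ v))) →
    (∀ {t h ts} l′ → Shows look t (focus l′ (bits (List.drop 1 v))) →
      Paths (conf (run leaf₀) t h ts) n k) →
    Paths (conf (run leaf₀) t h ts) (2 + n) (2 * k)
  leaves-fork v l {n = n} {k} sh rest = subst (Paths _ (2 + n)) (cong (k +_) (sym (+-identityʳ k)))
    (paths-fork (steps {st = leaf₀} (begins-1 sh)) p p)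
    where
    p : Paths _ (1 + n) k
    p with l′ , sh′ ← skips l (1b ∷ v) (here sh) sh = leaf₁-paths v l′ sh′ rest

  leaves : ∀ v l {t h ts} → Shows look t (focus l (bits v)) →
    Paths (conf (run leaf₀) t h ts) (length v * 2 + 2) (2 ^ lead v)
  leaves [] l sh = paths-mono (s≤s z≤n)
    (paths-then (steps {st = leaf₀} (ends-here sh)) (paths-halted 0 _))
  leaves (zero ∷ v) l sh = paths-mono (s≤s z≤n)
    (paths-then (steps {st = leaf₀} (begins-0 sh)) (paths-halted 0 _))
  leaves (suc zero ∷ []) l sh = leaves-fork [] l sh (λ l′ → leaves [] l′)
  leaves (suc zero ∷ b ∷ v) l sh =
    paths-mono (s≤s (s≤s (m≤n+m _ 2))) (leaves-fork (b ∷ v) l sh (λ l′ → leaves v l′))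

  module Summing (L : Language) (M-accepts-L : M Accepts L) where

    summand : Word → ℕ → ℕ
    summand w n = if L w then n else 0

    -- Defined on every word because the machine has to halt on every word. For `L = dyadic f` and a
    -- query with padding 1...1 of length m, the suffixes are the queries with shorter paddings, and
    -- the sum becomes `numeral (digits (f x)) m`.
    value : Word → ℕ
    value []                   = 0
    value (zero ∷ _)           = 0
    value (suc zero ∷ [])      = summand [ 1b ] 1
    value (suc zero ∷ b ∷ v)   = summand (1b ∷ b ∷ v) (2 ^ lead v) + value v

    BeginsAt : Word → ℕ → ℕ → Set
    BeginsAt v n k = ∀ {t ts} → (t ∷ ts) Shows* (fromCells (bits v) ∷ none) →
      Paths (conf (run begin₀) t (history []) ts) n k

    queried : ∀ w {t ts} → (t ∷ ts) Shows* (fromCells (bits w) ∷ none) →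
      Undone (run (undo₀ (L w))) (4 * eval (time M) (length w))
        (conf (run (sim start)) t (history []) ts) [] (fromCells (bits w) ∷ none)
    queried w sh with ends-det (eval (time M) (length w)) (initial (machine M) w)
    ... | d , eq = subst (λ b → Undone (run (undo₀ b)) _ _ _ _) (single-verdict M L M-accepts-L w eq)
      (undone (eval (time M) (length w)) (halts M w) eq sh)

    -- The cell is erased before the head moves on, so only blanks lie to the left and the shorter
    -- word looks like a fresh input.
    dropped : ∀ v {t} → Shows look t (fromCells (bits v)) →
      Shows look (act (blank , goRight) t) (fromCells (bits (List.drop 1 v)))
    dropped []            sh = Shows-≈ (act-Shows goRight refl sh) (blanksˡ [] blank [])
    dropped (b ∷ [])      sh = Shows-≈ (act-Shows goRight refl sh) (blanksˡ [] blank [])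
    dropped (b ∷ b′ ∷ v)  sh = Shows-≈ (act-Shows goRight refl sh) (blanksˡ [] (bit b′) (bits v))

    drops : ∀ v {t ts n k} → (t ∷ ts) Shows* (fromCells (bits v) ∷ none) →
      BeginsAt (List.drop 1 v) n k → Paths (conf (run drop₁) t (history []) ts) (1 + n) k
    drops v {t} {ts} (sh ∷ shs) rest =
      paths-then (step {st = drop₁} refl (≈ₜ-refl ∷ ≈ₜ-refl ∷ kept ts)) (rest (dropped v sh ∷ shs))

    paths-≈ : ∀ {c d : Config looper} {n k} → c ≈ d → Paths d n k → Paths c n k
    paths-≈ p = paths-then (⟹-refl p)

    -- The constants: one step to start the decider, four per step of its run, then `undo₀`, `undo₁`
    -- and one step over the bit of the pair.
    round : ∀ v {n k l} →
      (∀ {t h ts} l′ → Shows look t (focus l′ (bits (List.drop 1 v))) →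
        Paths (conf (run leaf₀) t h ts) n l) →
      BeginsAt (List.drop 1 v) n k →
      BeginsAt (1b ∷ v) (1 + (4 * eval (time M) (suc (length v)) + (3 + n))) (summand (1b ∷ v) l + k)
    round v {n} {k} {l} leaves-v rest {t} {ts} sh@(sh₀ ∷ _) =
      paths-then (step {st = begin₀} (begins-1 sh₀) (≈ₜ-refl ∷ ≈ₜ-refl ∷ kept ts))
      (paths-mono (+-monoˡ-≤ (3 + n) (Undone.bounded answered))
      (paths-then (Undone.arrives answered) (verdict (L (1b ∷ v)) (Undone.seen answered))))
      where
      answered = queried (1b ∷ v) sh
      verdict : ∀ b {t ts} → (t ∷ ts) Shows* (fromCells (bits (1b ∷ v)) ∷ none) →
        Paths (conf (run (undo₀ b)) t (history []) ts) (3 + n) ((if b then l else 0) + k)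
      verdict b {t} {ts} (sh ∷ shs) = paths-then
        (step {st = undo₀ b} {ts′ = t ∷ tape [] blank [ blank ] ∷ ts} refl (≈ₜ-refl ∷ ≈ₜ-refl ∷ kept ts))
        (branch b)
        where
        dropping : Paths {looper} (config (run drop₁) (act (blank , goRight) t ∷ tape [ blank ] blank [] ∷
          Vec.zipWith act (Vec.map keep (Vec.map head ts)) ts) []) (1 + n) k
        dropping = paths-≈ (same (≈ₜ-refl ∷ blanksˡ [] blank [] ∷ kept ts))
          (drops v (dropped (1b ∷ v) sh ∷ shs) rest)
        branch : ∀ b → Paths (conf (run (undo₁ b)) t (tape [] blank [ blank ]) ts) (2 + n)
                         ((if b then l else 0) + k)
        branch false = paths-then (steps {st = undo₁ false} refl) dropping
        branch true  with l′ , sh′ ← skips [] (1b ∷ v) (here sh) sh =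
          paths-fork (steps {st = undo₁ true} refl) (leaf₁-paths v l′ sh′ leaves-v) dropping

    -- A budget for one round that also covers a tree of leaves; the constant 10 leaves slack over
    -- the 4 that a round takes.
    K : Polynomial
    K = (con 4 ⊗ time M) ⊕ ((var ⊗ con 2) ⊕ con 10)

    module _ (N : ℕ) where
      open ≤-Reasoning

      leaf-time : ∀ {m} → m ≤ N → m * 2 + 2 ≤ eval K N
      leaf-time {m} m≤N = begin
        m * 2 + 2                       ≤⟨ +-mono-≤ (*-monoˡ-≤ 2 m≤N) (m≤m+n 2 8) ⟩
        N * 2 + 10                      ≤⟨ m≤n+m _ (4 * eval (time M) N) ⟩
        eval K N                        ∎

      round-time : ∀ {m} n → m ≤ N → 1 + (4 * eval (time M) m + (3 + n)) ≤ eval K N + n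
      round-time {m} n m≤N = begin
        1 + (4 * eval (time M) m + (3 + n))   ≡⟨ +-suc (4 * eval (time M) m) (3 + n) ⟨
        4 * eval (time M) m + (4 + n)
          ≤⟨ +-mono-≤ (*-monoʳ-≤ 4 (eval-mono (time M) m≤N))
               (+-monoˡ-≤ n (≤-trans (m≤m+n 4 6) (m≤n+m 10 (N * 2)))) ⟩
        4 * eval (time M) N + (N * 2 + 10 + n) ≡⟨ +-assoc (4 * eval (time M) N) (N * 2 + 10) n ⟨
        eval K N + n                          ∎

      1≤K : 1 ≤ eval K N
      1≤K = ≤-trans (s≤s z≤n) (leaf-time {0} z≤n)

      -- The bound `N` stays fixed while the word shrinks, so that every round has the same budget.
      begins : ∀ w → length w ≤ N → BeginsAt w (suc (length w) * eval K N) (suc (value w))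
      begins []         _ (sh ∷ _) = paths-mono (≤-trans 1≤K (m≤m+n _ 0))
        (paths-then (steps {st = begin₀} (ends-here sh)) (paths-halted 0 _))
      begins (zero ∷ v) _ (sh ∷ _) = paths-mono (≤-trans 1≤K (m≤m+n _ _))
        (paths-then (steps {st = begin₀} (begins-0 sh)) (paths-halted 0 _))
      begins (suc zero ∷ []) le sh = subst (Paths _ _)
        (trans (+-suc (summand [ 1b ] 1) 0) (cong suc (+-identityʳ _)))
        (paths-mono (round-time (1 * eval K N) le)
          (round [] (λ l sh′ → paths-mono (≤-trans (leaf-time {0} z≤n) (m≤m+n _ 0)) (leaves [] l sh′))
            (begins [] z≤n) sh))
      begins w@(suc zero ∷ b ∷ v) le sh = subst (Paths _ _) (+-suc (summand w (2 ^ lead v)) (value v))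
        (paths-mono (≤-trans (round-time (suc (length v) * eval K N) le) (m≤n+m _ (eval K N)))
          (round (b ∷ v) (λ l sh′ → paths-mono (≤-trans (leaf-time {length v} v≤N) (m≤m+n _ _)) (leaves v l sh′))
            (begins v v≤N) sh))
        where
        v≤N : length v ≤ N
        v≤N = ≤-trans (m≤n+m (length v) 2) le

    T-looper : Polynomial
    T-looper = (con 1 ⊕ var) ⊗ K

    initial-paths : ∀ w → Paths (initial looper w) (eval T-looper (length w)) (suc (value w))
    initial-paths w = begins (length w) w ≤-refl (bits-Shows w ∷ blanks-Shows* extraTapes)

    loop : NPTM
    loop = record
      { machine = looper
      ; time    = T-looper
      ; halts   = λ w → Paths.all-halted (initial-paths w)
      }

    Total-loop : ∀ w → Total loop w ≡ suc (value w)
    Total-loop w = Paths.count (initial-paths w)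

-- Indicator functions

indicator : Language → Word → ℕ
indicator L x = if L x then 1 else 0

count-++ : {A : Set} (p : A → Bool) → ∀ xs ys →
  length (filterᵇ p (xs ++ ys)) ≡ length (filterᵇ p xs) + length (filterᵇ p ys)
count-++ p []       ys = refl
count-++ p (x ∷ xs) ys with p x
... | true  = cong suc (count-++ p xs ys)
... | false = count-++ p xs ys

count-cong : {A B : Set} {p : A → Bool} {q : B → Bool} → ∀ {xs ys} →
  Pointwise (λ x y → p x ≡ q y) xs ys → length (filterᵇ p xs) ≡ length (filterᵇ q ys)
count-cong []         = refl
count-cong {p = p} {q} {x ∷ _} {y ∷ _} (eq ∷ eqs) with p x | q y | eq
... | true  | _ | refl = cong suc (count-cong eqs)
... | false | _ | refl = count-cong eqs

-- Lets a single accepting path witness a positive count, to which an `Accepts` equivalence applies.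
satisfied-count : {A : Set} (p : A → Bool) → ∀ xs → All (λ x → T (p x) → 0 < length (filterᵇ p xs)) xs
satisfied-count p []       = []
satisfied-count p (x ∷ xs) = first x xs ∷ All.map (λ f t → ≤-trans (f t) (others x xs)) (satisfied-count p xs)
  where
  first : ∀ x xs → T (p x) → 0 < length (filterᵇ p (x ∷ xs))
  first x xs t with p x | t
  ... | true | _ = s≤s z≤n
  others : ∀ x xs → length (filterᵇ p xs) ≤ length (filterᵇ p (x ∷ xs))
  others x xs with p x
  ... | true  = m≤n+m _ 1
  ... | false = ≤-refl

-- Complementing deterministic machines

module Flipping (M : NPTM) where
  open Machine (machine M)

  flipControl : Control Q → Control Q
  flipControl (run q) = run q
  flipControl accept  = reject
  flipControl reject  = accept

  flipStep : Transition Q G (suc extraTapes) → Transition Q G (suc extraTapes)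
  flipStep t = record { next = flipControl (next t) ; actions = actions t ; emit = emit t }

  flipper : Machine
  flipper = record
    { Q = Q ; Q-finite = Q-finite ; G = G ; G-finite = G-finite
    ; extraTapes = extraTapes ; start = start
    ; δ = λ q ss → List⁺.map flipStep (δ q ss) }

  data Flipped : Config (machine M) → Config flipper → Set where
    flipped : ∀ {ctl ts w} → Flipped (config ctl ts w) (config (flipControl ctl) ts w)

  flipped-simulation : Simulation (machine M) flipper Flipped
  flipped-simulation (flipped {run q} {ts}) =
    subst (Pointwise Flipped _) (map-∘ (toList (δ q (Vec.map head ts))))
      (Pw-map₂ (λ t → flipped) (toList (δ q (Vec.map head ts))))
  flipped-simulation (flipped {accept}) = flipped ∷ []
  flipped-simulation (flipped {reject}) = flipped ∷ []

  flipped-outcomes : ∀ x → Pointwise Flipped (outcomes M x)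
    (ends flipper (eval (time M) (length x)) (initial flipper x))
  flipped-outcomes x = ends-simulate flipped-simulation (eval (time M) (length x)) (flipped {run start})

  flipped-halted : ∀ {cs ds} → Pointwise Flipped cs ds → All Halted cs → All Halted ds
  flipped-halted [] [] = []
  flipped-halted (flipped {accept} ∷ fs) (h ∷ hs) = _ ∷ flipped-halted fs hs
  flipped-halted (flipped {reject} ∷ fs) (h ∷ hs) = _ ∷ flipped-halted fs hs

  flip : NPTM
  flip = record
    { machine = flipper ; time = time M
    ; halts = λ x → flipped-halted (flipped-outcomes x) (halts M x) }

  -- Exchanging the verdicts complements the language because there is a single path; with several,
  -- both verdicts may occur on one input.
  flip-accepts : Deterministic (machine M) → ∀ L → M Accepts L → flip Accepts (∁ L)
  flip-accepts det L acc = accepts-single flip (∁ L) single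
    where
    open DeterministicRuns (machine M) det
    one : ∀ {c cs ds} → cs ≡ [ c ] → Pointwise Flipped cs ds → All Halted cs →
      Σ[ d ∈ Config flipper ] (ds ≡ [ d ] × accepting d ≡ not (accepting c))
    one refl (flipped {accept} ∷ []) _ = _ , refl , refl
    one refl (flipped {reject} ∷ []) _ = _ , refl , refl
    one refl (flipped {run _} ∷ []) (() ∷ _)
    single : ∀ x → Σ[ d ∈ Config flipper ] (outcomes flip x ≡ [ d ] × accepting d ≡ not (L x))
    single x with ends-det (eval (time M) (length x)) (initial (machine M) x)
    ... | c , eq with one eq (flipped-outcomes x) (halts M x)
    ... | d , eq′ , v = d , eq′ , trans v (cong not (single-verdict M L acc x eq))

-- Since f x + 1 paths are one or two, it suffices to accept at the first branching.
module Detecting (M : NPTM) where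
  open Machine (machine M)

  demote : Control Q → Control Q
  demote (run q) = run q
  demote _       = reject

  Step : Set
  Step = Transition Q G (suc extraTapes)

  detect : List⁺ Step → List⁺ Step
  detect (t ∷ [])    = record { next = demote (next t) ; actions = actions t ; emit = nothing } ∷ []
  detect (t ∷ _ ∷ _) = record { next = accept ; actions = actions t ; emit = nothing } ∷ []

  detector : Machine
  detector = record
    { Q = Q ; Q-finite = Q-finite ; G = G ; G-finite = G-finite
    ; extraTapes = extraTapes ; start = start
    ; δ = λ q ss → detect (δ q ss) }

  detector-deterministic : Deterministic detector
  detector-deterministic q ss with δ q ss
  ... | _ ∷ []    = refl
  ... | _ ∷ _ ∷ _ = refl

  Detects : ℕ → Config (machine M) → Config detector → Set
  Detects n c e = Σ[ d ∈ Config detector ]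
    (ends detector n e ≡ [ d ] × Halted d × accepting d ≡ (1 <ᵇ length (ends (machine M) n c)))

  -- Each branch contributes at least one path, so a branching already forces two paths and the
  -- detector may stop there.
  ends-nonempty : ∀ n c → 1 ≤ length (ends (machine M) n c)
  ends-nonempty zero    c = s≤s z≤n
  ends-nonempty (suc n) (config (run q) ts w) with δ q (Vec.map head ts)
  ... | t ∷ us = subst (1 ≤_) (sym (length-++ (ends (machine M) n (apply (machine M) ts w t))))
                   (≤-trans (ends-nonempty n _) (m≤m+n _ _))
  ends-nonempty (suc n) c@(config accept _ _) =
    subst (λ es → 1 ≤ length es) (sym (ends-halted (suc n) {c} _)) (s≤s z≤n)
  ends-nonempty (suc n) c@(config reject _ _) =
    subst (λ es → 1 ≤ length es) (sym (ends-halted (suc n) {c} _)) (s≤s z≤n)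

  detects-halted : ∀ n {c ts w} → Halted {machine M} c → Detects n c (config reject ts w)
  detects-halted n {c} {ts} {w} h = _ , ends-halted n {config reject ts w} _ , _ ,
    cong (λ es → 1 <ᵇ length es) (sym (ends-halted n {c} h))

  detects : ∀ n ctl {ts v w} → All Halted (ends (machine M) n (config ctl ts v)) →
            Detects n (config ctl ts v) (config (demote ctl) ts w)
  detects n       accept _ = detects-halted n _
  detects n       reject _ = detects-halted n _
  detects zero    (run q) (() ∷ _)
  detects (suc n) (run q) {ts} {v} {w} hs with δ q (Vec.map head ts)
  ... | t ∷ [] with ends (machine M) n (apply (machine M) ts v t) ++ [] | ++-identityʳ (ends (machine M) n (apply (machine M) ts v t))
  ...   | _ | refl with detects n (next t) {w = w ++ []} hs
  ...     | d , eq , h , v′ = d , cong (_++ []) eq , h , v′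
  detects (suc n) (run q) {ts} {v} {w} hs | t ∷ u ∷ us =
    _ , cong (_++ []) (ends-halted n {config accept _ _} _) , _ ,
    sym (two (ends (machine M) n (apply (machine M) ts v t)) (ends (machine M) n (apply (machine M) ts v u))
      (ends-nonempty n _) (ends-nonempty n _))
    where
    two : ∀ {A : Set} (xs ys : List A) {zs} → 1 ≤ length xs → 1 ≤ length ys →
          (1 <ᵇ length (xs ++ ys ++ zs)) ≡ true
    two (_ ∷ [])    (_ ∷ _) _ _ = refl
    two (_ ∷ _ ∷ _) _       _ _ = refl

  detect-halts : ∀ x → Detects (eval (time M) (length x)) (initial (machine M) x) (initial detector x)
  detect-halts x = detects (eval (time M) (length x)) (run start) (halts M x)

  detectNPTM : NPTM
  detectNPTM = record
    { machine = detector ; time = time M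
    ; halts = λ x → let d , eq , h , _ = detect-halts x in subst (All Halted) (sym eq) (h ∷ []) }

  detects-branching : ∀ L → (∀ x → L x ≡ (1 <ᵇ Total M x)) → detectNPTM Accepts L
  detects-branching L branches = accepts-single detectNPTM L λ x →
    let d , eq , _ , v = detect-halts x in d , eq , trans v (sym (branches x))

-- Computing the indicator of a language in NP ∩ coNP

module Choosing (M₁ M₂ : NPTM) where
  module A = Machine (machine M₁)
  module B = Machine (machine M₂)

  Letter State : Set
  Letter = A.G ⊎ B.G
  State  = Fin 1 ⊎ A.Q ⊎ B.Q

  pattern choose = inj₁ zero
  pattern simᵃ q = inj₂ (inj₁ q)
  pattern simᵇ q = inj₂ (inj₂ q)

  -- Only one of the machines is run on a path, so they share the input tape; the extra tapes are
  -- kept apart.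
  k : ℕ
  k = A.extraTapes + B.extraTapes

  Step : Set
  Step = Transition State Letter (suc k)

  -- The bit is emitted by the very transition that accepts, and simulated output is dropped, so an
  -- accepting path outputs this bit alone.
  report : {Q : Set} → Bit → Control Q → Maybe Bit
  report b accept = just b
  report b _      = nothing

  module a = View (leftView {A.G} {B.G})
  module b = View (rightView {A.G} {B.G})

  selectᵃ : {X : Set} → Vec X (suc k) → Vec X (suc A.extraTapes)
  selectᵃ (x ∷ xs) = x ∷ Vec.take A.extraTapes xs

  selectᵇ : {X : Set} → Vec X (suc k) → Vec X (suc B.extraTapes)
  selectᵇ (x ∷ xs) = x ∷ Vec.drop A.extraTapes xs

  Act : Set
  Act = Symbol Letter × Direction

  placeᵃ : Vec Act (suc A.extraTapes) → Vec (Symbol Letter) (suc k) → Vec Act (suc k)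
  placeᵃ (a ∷ as) (s ∷ ss) = a ∷ as Vec.++ Vec.map keep (Vec.drop A.extraTapes ss)

  placeᵇ : Vec Act (suc B.extraTapes) → Vec (Symbol Letter) (suc k) → Vec Act (suc k)
  placeᵇ (a ∷ as) (s ∷ ss) = a ∷ Vec.map keep (Vec.take A.extraTapes ss) Vec.++ as

  take-act : ∀ m {n} as bs (ts : Vec (Tape Letter) (m + n)) →
    Vec.take m (Vec.zipWith act (as Vec.++ bs) ts) ≡ Vec.zipWith act as (Vec.take m ts)
  take-act zero    []       bs ts       = refl
  take-act (suc m) (a ∷ as) bs (t ∷ ts) = cong (_ ∷_) (take-act m as bs ts)

  drop-act : ∀ m {n} (bs : Vec Act m) as (ts : Vec (Tape Letter) (m + n)) →
    Vec.drop m (Vec.zipWith act (bs Vec.++ as) ts) ≡ Vec.zipWith act as (Vec.drop m ts)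
  drop-act zero    []       as ts       = refl
  drop-act (suc m) (_ ∷ bs) as (t ∷ ts) = drop-act m bs as ts

  simStepᵃ : Vec (Symbol Letter) (suc k) → Transition A.Q A.G (suc A.extraTapes) → Step
  simStepᵃ ss t = record
    { next = mapControl (λ q → simᵃ q) (next t)
    ; actions = placeᵃ (Vec.map a.lift (actions t)) ss
    ; emit = report 1b (next t) }

  simStepᵇ : Vec (Symbol Letter) (suc k) → Transition B.Q B.G (suc B.extraTapes) → Step
  simStepᵇ ss t = record
    { next = mapControl (λ q → simᵇ q) (next t)
    ; actions = placeᵇ (Vec.map b.lift (actions t)) ss
    ; emit = report 0b (next t) }

  pass : State → Vec (Symbol Letter) (suc k) → Step
  pass q ss = record { next = run q ; actions = Vec.map keep ss ; emit = nothing }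

  δ′ : State → Vec (Symbol Letter) (suc k) → List⁺ Step
  δ′ choose   ss = pass (simᵃ A.start) ss ∷ pass (simᵇ B.start) ss ∷ []
  δ′ (simᵃ q) ss = List⁺.map (simStepᵃ ss) (A.δ q (Vec.map a.look (selectᵃ ss)))
  δ′ (simᵇ q) ss = List⁺.map (simStepᵇ ss) (B.δ q (Vec.map b.look (selectᵇ ss)))

  chooser : Machine
  chooser = record
    { Q          = State
    ; Q-finite   = finite-⊎ (finite-Fin 1) (finite-⊎ A.Q-finite B.Q-finite)
    ; G          = Letter
    ; G-finite   = finite-⊎ A.G-finite B.G-finite
    ; extraTapes = k
    ; start      = choose
    ; δ          = δ′
    }

  data Hostsᵃ : Config (machine M₁) → Config chooser → Set where
    hosts : ∀ {ctl us v ts w} → selectᵃ ts a.Shows* us → w ≡ List.fromMaybe (report 1b ctl) →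
            Hostsᵃ (config ctl us v) (config (mapControl (λ q → simᵃ q) ctl) ts w)

  data Hostsᵇ : Config (machine M₂) → Config chooser → Set where
    hosts : ∀ {ctl us v ts w} → selectᵇ ts b.Shows* us → w ≡ List.fromMaybe (report 0b ctl) →
            Hostsᵇ (config ctl us v) (config (mapControl (λ q → simᵇ q) ctl) ts w)

  headsᵃ : ∀ {ts us} → selectᵃ ts a.Shows* us →
           Vec.map a.look (selectᵃ (Vec.map head ts)) ≡ Vec.map head us
  headsᵃ {t ∷ ts} sh = trans
    (cong (λ ss → Vec.map a.look (head t ∷ ss)) (VecP.take-map head A.extraTapes ts))
    (a.heads-Shows* sh)

  headsᵇ : ∀ {ts us} → selectᵇ ts b.Shows* us →
           Vec.map b.look (selectᵇ (Vec.map head ts)) ≡ Vec.map head us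
  headsᵇ {t ∷ ts} sh = trans
    (cong (λ ss → Vec.map b.look (head t ∷ ss)) (VecP.drop-map head A.extraTapes ts))
    (b.heads-Shows* sh)

  actsᵃ : ∀ {ts us} as → selectᵃ ts a.Shows* us →
    selectᵃ (Vec.zipWith act (placeᵃ (Vec.map a.lift as) (Vec.map head ts)) ts) a.Shows*
      Vec.zipWith act as us
  actsᵃ {t ∷ ts} (a ∷ as) sh = subst (λ us → (_ ∷ us) a.Shows* _)
    (sym (take-act A.extraTapes (Vec.map a.lift as) _ ts)) (a.act-Shows* (a ∷ as) sh)

  actsᵇ : ∀ {ts us} as → selectᵇ ts b.Shows* us →
    selectᵇ (Vec.zipWith act (placeᵇ (Vec.map b.lift as) (Vec.map head ts)) ts) b.Shows*
      Vec.zipWith act as us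
  actsᵇ {t ∷ ts} (a ∷ as) sh = subst (λ us → (_ ∷ us) b.Shows* _)
    (sym (drop-act A.extraTapes _ (Vec.map b.lift as) ts)) (b.act-Shows* (a ∷ as) sh)

  simulationᵃ : Simulation (machine M₁) chooser Hostsᵃ
  simulationᵃ (hosts {run q} {us} {ts = ts} sh refl) rewrite headsᵃ {ts} sh =
    subst (Pointwise Hostsᵃ _) (map-∘ (toList (A.δ q (Vec.map head us))))
      (Pw-map₂ (λ t → hosts (actsᵃ {ts} (actions t) sh) refl) (toList (A.δ q (Vec.map head us))))
  simulationᵃ (hosts {accept} sh eq) = hosts sh eq ∷ []
  simulationᵃ (hosts {reject} sh eq) = hosts sh eq ∷ []

  simulationᵇ : Simulation (machine M₂) chooser Hostsᵇ
  simulationᵇ (hosts {run q} {us} {ts = ts} sh refl) rewrite headsᵇ {ts} sh =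
    subst (Pointwise Hostsᵇ _) (map-∘ (toList (B.δ q (Vec.map head us))))
      (Pw-map₂ (λ t → hosts (actsᵇ {ts} (actions t) sh) refl) (toList (B.δ q (Vec.map head us))))
  simulationᵇ (hosts {accept} sh eq) = hosts sh eq ∷ []
  simulationᵇ (hosts {reject} sh eq) = hosts sh eq ∷ []

  reportedᵃ : ∀ {c d} → Hostsᵃ c d → SameVerdict d c × (T (accepting d) → output d ≡ [ 1b ])
  reportedᵃ (hosts {run _}  _ _)  = (refl , refl) , λ ()
  reportedᵃ (hosts {accept} _ eq) = (refl , refl) , λ _ → eq
  reportedᵃ (hosts {reject} _ _)  = (refl , refl) , λ ()

  reportedᵇ : ∀ {c d} → Hostsᵇ c d → SameVerdict d c × (T (accepting d) → output d ≡ [ 0b ])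
  reportedᵇ (hosts {run _}  _ _)  = (refl , refl) , λ ()
  reportedᵇ (hosts {accept} _ eq) = (refl , refl) , λ _ → eq
  reportedᵇ (hosts {reject} _ _)  = (refl , refl) , λ ()

  take-replicate : ∀ {X : Set} m n (x : X) → Vec.take m (Vec.replicate (m + n) x) ≡ Vec.replicate m x
  take-replicate zero    n x = refl
  take-replicate (suc m) n x = cong (x ∷_) (take-replicate m n x)

  drop-replicate : ∀ {X : Set} m n (x : X) → Vec.drop m (Vec.replicate (m + n) x) ≡ Vec.replicate n x
  drop-replicate zero    n x = refl
  drop-replicate (suc m) n x = drop-replicate m n x

  T-sim : ℕ → ℕ
  T-sim n = eval (time M₁) n + eval (time M₂) n

  module _ (x : Word) where

    tapes₀ : Vec (Tape Letter) (suc k)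
    tapes₀ = tapes (initial chooser x)

    runᵃ runᵇ : List (Config chooser)
    runᵃ = ends chooser (T-sim (length x)) (config (run (simᵃ A.start)) tapes₀ [])
    runᵇ = ends chooser (T-sim (length x)) (config (run (simᵇ B.start)) tapes₀ [])

    runs : ends chooser (suc (T-sim (length x))) (initial chooser x) ≡ runᵃ ++ runᵇ
    runs = trans
      (cong (λ ts → concatMap (ends chooser (T-sim (length x)))
          (config (run (simᵃ A.start)) ts [] ∷ config (run (simᵇ B.start)) ts [] ∷ []))
        (act-keep tapes₀))
      (cong (runᵃ ++_) (++-identityʳ runᵇ))

    hostᵃ : Pointwise Hostsᵃ (outcomes M₁ x) runᵃ
    hostᵃ = subst (λ cs → Pointwise Hostsᵃ cs runᵃ)
      (ends-stable {m = eval (time M₁) (length x)} (halts M₁ x) (m≤m+n _ _))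
      (ends-simulate simulationᵃ (T-sim (length x)) (hosts {ctl = run A.start} shown refl))
      where
      shown : selectᵃ tapes₀ a.Shows* tapes (initial (machine M₁) x)
      shown rewrite take-replicate A.extraTapes B.extraTapes (fromCells {Letter} []) =
        a.bits-Shows x ∷ a.blanks-Shows* A.extraTapes

    hostᵇ : Pointwise Hostsᵇ (outcomes M₂ x) runᵇ
    hostᵇ = subst (λ cs → Pointwise Hostsᵇ cs runᵇ)
      (ends-stable {m = eval (time M₂) (length x)} (halts M₂ x) (m≤n+m _ (eval (time M₁) (length x))))
      (ends-simulate simulationᵇ (T-sim (length x)) (hosts {ctl = run B.start} {v = []} shown refl))
      where
      shown : selectᵇ tapes₀ b.Shows* tapes (initial (machine M₂) x)
      shown rewrite drop-replicate A.extraTapes B.extraTapes (fromCells {Letter} []) =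
        b.bits-Shows x ∷ b.blanks-Shows* B.extraTapes

    countᵃ : length (filterᵇ accepting runᵃ) ≡ acc M₁ x
    countᵃ = sym (count-cong (Pw.map (λ h → sym (proj₁ (proj₁ (reportedᵃ h)))) hostᵃ))

    countᵇ : length (filterᵇ accepting runᵇ) ≡ acc M₂ x
    countᵇ = sym (count-cong (Pw.map (λ h → sym (proj₁ (proj₁ (reportedᵇ h)))) hostᵇ))

  chooseNPTM : NPTM
  chooseNPTM = record
    { machine = chooser
    ; time = con 1 ⊕ (time M₁ ⊕ time M₂)
    ; halts = λ x → subst (All Halted) (sym (runs x)) (AllP.++⁺
        (SameVerdict-halted (Pw.symmetric (λ h → proj₁ (reportedᵃ h)) (hostᵃ x)) (halts M₁ x))
        (SameVerdict-halted (Pw.symmetric (λ h → proj₁ (reportedᵇ h)) (hostᵇ x)) (halts M₂ x)))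
    }

  All-Pw : {A B : Set} {R : A → B → Set} {S : B → Set} → (∀ {x y} → R x y → S y) →
    ∀ {xs ys} → Pointwise R xs ys → All S ys
  All-Pw f []       = []
  All-Pw f (r ∷ rs) = f r ∷ All-Pw f rs

  -- An accepting path through `M₁` forces x into `L` and one through `M₂` forces it out, so
  -- accepting paths agree; on every x one of the machines accepts.
  indicator-NPSVₜ : ∀ L → M₁ Accepts L → M₂ Accepts ∁ L → NPSVₜ (indicator L)
  indicator-NPSVₜ L accᵃ accᵇ = chooseNPTM , λ x →
    subst (0 <_) (sym (trans (cong (length ∘ filterᵇ accepting) (runs x))
      (trans (count-++ accepting (runᵃ x) (runᵇ x)) (cong₂ _+_ (countᵃ x) (countᵇ x))))) (some x) ,
    subst (All _) (sym (runs x)) (AllP.++⁺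
      (All.zipWith (λ (out , pos) acc → outᵃ x (subst (0 <_) (countᵃ x) (pos acc)) (out acc))
        (All-Pw (proj₂ ∘ reportedᵃ) (hostᵃ x) , satisfied-count accepting (runᵃ x)))
      (All.zipWith (λ (out , pos) acc → outᵇ x (subst (0 <_) (countᵇ x) (pos acc)) (out acc))
        (All-Pw (proj₂ ∘ reportedᵇ) (hostᵇ x) , satisfied-count accepting (runᵇ x))))
    where
    some : ∀ x → 0 < acc M₁ x + acc M₂ x
    some x with L x in Lx
    ... | true  = ≤-trans (Equivalence.to (accᵃ x) Lx) (m≤m+n _ _)
    ... | false = ≤-trans (Equivalence.to (accᵇ x) (cong not Lx)) (m≤n+m _ _)
    outᵃ : ∀ x → 0 < acc M₁ x → ∀ {w} → w ≡ [ 1b ] → w ≡ binary (indicator L x)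
    outᵃ x pos eq rewrite Equivalence.from (accᵃ x) pos = eq
    outᵇ : ∀ x → 0 < acc M₂ x → ∀ {w} → w ≡ [ 0b ] → w ≡ binary (indicator L x)
    outᵇ x pos eq with L x | Equivalence.from (accᵇ x) pos
    ... | false | _ = eq

-- Binary digits

digits : ℕ → List Bit
digits n = proj₁ (toDigits 2 n)

-- The value of the lowest `m` digits, peeled from the top because one more bit of padding brings in
-- the next higher weight; `numeral-∷` links it to the Horner form of `fromDigits`.
numeral : List Bit → ℕ → ℕ
numeral ds zero    = 0
numeral ds (suc m) = (if digitAt ds m then 2 ^ m else 0) + numeral ds m

numeral-[] : ∀ m → numeral [] m ≡ 0
numeral-[] zero    = refl
numeral-[] (suc m) = numeral-[] m

numeral-∷ : ∀ d ds m → numeral (d ∷ ds) (suc m) ≡ toℕ d + numeral ds m * 2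
numeral-∷ zero       ds zero    = refl
numeral-∷ (suc zero) ds zero    = refl
numeral-∷ d          ds (suc m) = begin
  (if digitAt ds m then 2 ^ suc m else 0) + numeral (d ∷ ds) (suc m)
    ≡⟨ cong₂ _+_ (double (digitAt ds m)) (numeral-∷ d ds m) ⟩
  (if digitAt ds m then 2 ^ m else 0) * 2 + (toℕ d + numeral ds m * 2)
    ≡⟨ x∙yz≈y∙xz +-commutativeSemigroup ((if digitAt ds m then 2 ^ m else 0) * 2) (toℕ d) (numeral ds m * 2) ⟩
  toℕ d + ((if digitAt ds m then 2 ^ m else 0) * 2 + numeral ds m * 2)
    ≡⟨ cong (toℕ d +_) (*-distribʳ-+ 2 (if digitAt ds m then 2 ^ m else 0) (numeral ds m)) ⟨
  toℕ d + numeral ds (suc m) * 2 ∎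
  where
  open ≡-Reasoning
  double : ∀ b → (if b then 2 ^ suc m else 0) ≡ (if b then 2 ^ m else 0) * 2
  double true  = *-comm 2 (2 ^ m)
  double false = refl

numeral-fromDigits : ∀ ds m → length ds ≤ m → numeral ds m ≡ fromDigits ds
numeral-fromDigits []       m       _          = numeral-[] m
numeral-fromDigits (d ∷ ds) (suc m) (s≤s le) =
  trans (numeral-∷ d ds m) (cong (λ n → toℕ d + n * 2) (numeral-fromDigits ds m le))

numeral-digits : ∀ n m → length (digits n) ≤ m → numeral (digits n) m ≡ n
numeral-digits n m le = trans (numeral-fromDigits (digits n) m le) (proj₂ (toDigits 2 n))

sum-const : {A : Set} (f : A → ℕ) → ∀ n {xs} → All (λ x → f x ≡ n) xs → sum (List.map f xs) ≡ length xs * n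
sum-const f n []         = refl
sum-const f n (eq ∷ eqs) = cong₂ _+_ eq (sum-const f n eqs)

binaryWords : ℕ → List Word
binaryWords = wordsOver (0b ∷ 1b ∷ [])

length-binaryWords : ∀ m → length (binaryWords m) ≡ 2 ^ m
length-binaryWords zero    = refl
length-binaryWords (suc m) = begin
  length (List.map (0b ∷_) W ++ List.map (1b ∷_) W ++ [])
    ≡⟨ length-++ (List.map (0b ∷_) W) ⟩
  length (List.map (0b ∷_) W) + length (List.map (1b ∷_) W ++ [])
    ≡⟨ cong₂ _+_ (length-map _ W) (trans (length-++ (List.map (1b ∷_) W)) (cong (_+ 0) (length-map _ W))) ⟩
  2 * length W
    ≡⟨ cong (2 *_) (length-binaryWords m) ⟩
  2 ^ suc m ∎
  where
  open ≡-Reasoning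
  W = binaryWords m

holding : List Bit → Word → ℕ
holding ds ys = if holds ys ds then 1 else 0

-- A word 0v holds iff v does, which yields the lower digits. Whether 1u holds depends on |u| alone,
-- so either all 2 ^ |u| such words hold or none.
sum-holding : ∀ ds m → sum (List.map (holding ds) (binaryWords m)) ≡ numeral ds m
sum-holding ds zero    = refl
sum-holding ds (suc m) = begin
  sum (List.map (holding ds) (List.map (0b ∷_) W ++ List.map (1b ∷_) W ++ []))
    ≡⟨ cong (λ ws → sum (List.map (holding ds) (List.map (0b ∷_) W ++ ws))) (++-identityʳ _) ⟩
  sum (List.map (holding ds) (List.map (0b ∷_) W ++ List.map (1b ∷_) W))
    ≡⟨ cong sum (map-++ (holding ds) (List.map (0b ∷_) W) _) ⟩
  sum (List.map (holding ds) (List.map (0b ∷_) W) ++ List.map (holding ds) (List.map (1b ∷_) W))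
    ≡⟨ sum-++ (List.map (holding ds) (List.map (0b ∷_) W)) _ ⟩
  sum (List.map (holding ds) (List.map (0b ∷_) W)) + sum (List.map (holding ds) (List.map (1b ∷_) W))
    ≡⟨ cong₂ (λ u v → sum u + sum v) (map-∘ W) (map-∘ W) ⟨
  sum (List.map (holding ds) W) + sum (List.map (holding ds ∘ (1b ∷_)) W)
    ≡⟨ cong₂ _+_ (sum-holding ds m) ones ⟩
  numeral ds m + (if digitAt ds m then 2 ^ m else 0)
    ≡⟨ +-comm (numeral ds m) _ ⟩
  numeral ds (suc m) ∎
  where
  open ≡-Reasoning
  W = binaryWords m
  times : ∀ b n → n * (if b then 1 else 0) ≡ (if b then n else 0)
  times true  n = *-identityʳ n
  times false n = *-zeroʳ n
  ones : sum (List.map (holding ds ∘ (1b ∷_)) W) ≡ (if digitAt ds m then 2 ^ m else 0)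
  ones = trans (sum-const _ (if digitAt ds m then 1 else 0)
      (All.map (cong (λ n → if digitAt ds n then 1 else 0)) (length-wordsOver _ m)))
    (trans (cong (_* (if digitAt ds m then 1 else 0)) (length-binaryWords m)) (times (digitAt ds m) (2 ^ m)))

-- Queries, the digit language and the width of the padding

decode-pushPairs₁ : ∀ u w xs ys → decode (pushPairs 1b u w) xs ys ≡ decode w xs (u ++ ys)
decode-pushPairs₁ []      w xs ys = refl
decode-pushPairs₁ (b ∷ u) w xs ys = decode-pushPairs₁ u (1b ∷ b ∷ w) xs ys

decode-pushPairs₀ : ∀ u w xs ys → decode (pushPairs 0b u w) xs ys ≡ decode w (u ++ xs) ys
decode-pushPairs₀ []      w xs ys = refl
decode-pushPairs₀ (b ∷ u) w xs ys = decode-pushPairs₀ u (0b ∷ b ∷ w) xs ys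

decode-query : ∀ ys x → decode (query ys x) [] [] ≡ (x , ys)
decode-query ys x = begin
  decode (query ys x) [] []               ≡⟨ decode-pushPairs₁ ys _ [] [] ⟩
  decode (pushPairs 0b x []) [] (ys ++ []) ≡⟨ decode-pushPairs₀ x [] [] (ys ++ []) ⟩
  (x ++ [] , ys ++ [])                    ≡⟨ cong₂ _,_ (++-identityʳ x) (++-identityʳ ys) ⟩
  (x , ys)                                ∎
  where open ≡-Reasoning

dyadic : (Word → ℕ) → Language
dyadic f w = holds (paddingOf w) (digits (f (wordOf w)))

dyadic-query : ∀ f ys x → dyadic f (query ys x) ≡ holds ys (digits (f x))
dyadic-query f ys x = cong (λ (x , ys) → holds ys (digits (f x))) (decode-query ys x)

-- The base is at least 2 even for the empty word, so one more factor absorbs a sum, and constants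
-- are bounded as well.
dominate : ∀ p → Σ[ D ∈ ℕ ] (∀ n → eval p n ≤ (2 + n) ^ D)
dominate var     = 1 , λ n → ≤-trans (m≤n+m n 2) (≤-reflexive (sym (*-identityʳ (2 + n))))
dominate (con c) = c , λ n → constant c n
  where
  open ≤-Reasoning
  constant : ∀ c n → c ≤ (2 + n) ^ c
  constant zero    n = z≤n
  constant (suc c) n = begin
    1 + c                          ≤⟨ +-mono-≤ (m^n>0 (2 + n) c) (constant c n) ⟩
    (2 + n) ^ c + (2 + n) ^ c      ≤⟨ +-monoʳ-≤ ((2 + n) ^ c) (m≤m+n ((2 + n) ^ c) _) ⟩
    (2 + n) ^ suc c                ∎
dominate (p ⊕ q) with dominate p | dominate q
... | a , p≤ | b , q≤ = suc (a + b) , λ n → begin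
    eval p n + eval q n            ≤⟨ +-mono-≤ (p≤ n) (q≤ n) ⟩
    (2 + n) ^ a + (2 + n) ^ b
      ≤⟨ +-mono-≤ (^-monoʳ-≤ (2 + n) (m≤m+n a b)) (^-monoʳ-≤ (2 + n) (m≤n+m b a)) ⟩
    (2 + n) ^ (a + b) + (2 + n) ^ (a + b)
      ≤⟨ +-monoʳ-≤ ((2 + n) ^ (a + b)) (m≤m+n ((2 + n) ^ (a + b)) _) ⟩
    (2 + n) ^ suc (a + b)          ∎
  where open ≤-Reasoning
dominate (p ⊗ q) with dominate p | dominate q
... | a , p≤ | b , q≤ = a + b , λ n →
  ≤-trans (*-mono-≤ (p≤ n) (q≤ n)) (≤-reflexive (sym (^-distribˡ-+-* (2 + n) a b)))

length-emitted : ∀ e → length (List.fromMaybe {A = Bit} e) ≤ 1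
length-emitted nothing  = z≤n
length-emitted (just _) = ≤-refl

length-output : ∀ {M} n (c : Config M) →
  All (λ d → length (output d) ≤ n + length (output c)) (ends M n c)
length-output zero    c = ≤-refl ∷ []
length-output {M} (suc n) (config (run q) ts w) =
  AllP.concat⁺ (AllP.map⁺ {f = ends M n} (AllP.map⁺ {f = apply M ts w}
    (All.universal grows (toList (Machine.δ M q (Vec.map head ts))))))
  where
  open ≤-Reasoning
  grows : ∀ t → All (λ d → length (output d) ≤ suc n + length w) (ends M n (apply M ts w t))
  grows t = All.map (λ {d} le → begin
    length (output d)                              ≤⟨ le ⟩
    n + length (w ++ List.fromMaybe (emit t))      ≡⟨ cong (n +_) (length-++ w) ⟩
    n + (length w + length (List.fromMaybe (emit t)))
      ≤⟨ +-monoʳ-≤ n (+-monoʳ-≤ (length w) (length-emitted (emit t))) ⟩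
    n + (length w + 1)                             ≡⟨ cong (n +_) (+-comm (length w) 1) ⟩
    n + suc (length w)                             ≡⟨ +-suc n (length w) ⟩
    suc n + length w                               ∎) (length-output n (apply M ts w t))
length-output (suc n) c@(config accept _ _) =
  subst (All _) (sym (ends-halted (suc n) {c} _)) (m≤n+m _ (suc n) ∷ [])
length-output (suc n) c@(config reject _ _) =
  subst (All _) (sym (ends-halted (suc n) {c} _)) (m≤n+m _ (suc n) ∷ [])

satisfied : {A P : Set} {p : A → Bool} → ∀ {xs} →
  0 < length (filterᵇ p xs) → All (λ x → T (p x) → P) xs → P
satisfied {p = p} {x ∷ xs} pos (f ∷ fs) with p x
... | true  = f _
... | false = satisfied {p = p} {xs} pos fs

-- Some path outputs `binary (f x)`, and a path emits at most one bit per step.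
length-digits : ∀ (f : Word → ℕ) (M : NPTM) x → 0 < acc M x →
  All (λ c → T (accepting c) → output c ≡ binary (f x)) (outcomes M x) →
  length (digits (f x)) ≤ eval (time M) (length x)
length-digits f M x pos outs = satisfied {p = accepting} pos
  (All.zipWith (λ {c} (le , out) acc → begin
      length (digits (f x))           ≡⟨ length-reverse (digits (f x)) ⟨
      length (binary (f x))           ≡⟨ cong length (out acc) ⟨
      length (output c)               ≤⟨ le ⟩
      eval (time M) (length x) + 0    ≡⟨ +-identityʳ _ ⟩
      eval (time M) (length x)        ∎)
    (length-output (eval (time M) (length x)) (initial (machine M) x) , outs))
  where open ≤-Reasoning

-- The digit language lies in NP ∩ coNP

module Digits (f : Word → ℕ) (M : NPTM)
  (computes : ∀ x → 0 < acc M x ×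
    All (λ c → T (accepting c) → output c ≡ binary (f x)) (outcomes M x)) where

  -- All accepting paths of `M` output `binary (f x)`, so they are judged alike, and there is at
  -- least one. Taking `id` and `not` for `judge` gives NP and coNP.
  verify-accepts : ∀ judge → Verifying.verify M judge Accepts (judge ∘ dyadic f)
  verify-accepts judge w = mk⇔
    (λ J → subst (0 <_) (count-cong (same-verdicts J)) (proj₁ (computes x)))
    (λ pos → some-accept _ refl pos)
    where
    open Verifying M judge
    x = wordOf w

    verdicts : ∀ {cs ds} → All (λ c → T (accepting c) → output c ≡ binary (f x)) cs →
      Pointwise (Judged (paddingOf w)) cs ds →
      Pointwise (λ c d → accepting c ∧ judge (dyadic f w) ≡ accepting d) cs ds
    verdicts []           []                             = []
    verdicts {c ∷ _} (out ∷ outs) (judging _ v ∷ js) = trans (agree (accepting c) out) (sym v) ∷ verdicts outs js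
      where
      agree : ∀ b → (T b → output c ≡ binary (f x)) →
        b ∧ judge (dyadic f w) ≡ b ∧ judge (holds (paddingOf w) (reverse (output c)))
      agree false _ = refl
      agree true out = cong (λ ds → judge (holds (paddingOf w) ds))
        (sym (trans (cong reverse (out _)) (reverse-involutive (digits (f x)))))

    all-verdicts : Pointwise (λ c d → accepting c ∧ judge (dyadic f w) ≡ accepting d)
      (outcomes M x) (outcomes verify w)
    all-verdicts = verdicts (proj₂ (computes x)) (ends-verifier w)

    same-verdicts : judge (dyadic f w) ≡ true →
      Pointwise (λ c d → accepting c ≡ accepting d) (outcomes M x) (outcomes verify w)
    same-verdicts J = Pw.map (λ {c} eq → trans (sym (trans (cong (accepting c ∧_) J) (∧-identityʳ _))) eq) all-verdicts

    none-accept : judge (dyadic f w) ≡ false → acc verify w ≡ 0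
    none-accept J = trans (sym (count-cong {p = λ _ → false}
      (Pw.map (λ {c} eq → trans (sym (trans (cong (accepting c ∧_) J) (∧-zeroʳ _))) eq) all-verdicts)))
      (count-none (outcomes M x))
      where
      count-none : {A : Set} (xs : List A) → length (filterᵇ (λ _ → false) xs) ≡ 0
      count-none []       = refl
      count-none (_ ∷ xs) = count-none xs

    some-accept : ∀ b → judge (dyadic f w) ≡ b → 0 < acc verify w → judge (dyadic f w) ≡ true
    some-accept true  J _   = J
    some-accept false J pos = ⊥-elim (n≮0 (subst (0 <_) (none-accept J) pos))

  dyadic-NP∩coNP : (NP ∩ coNP) (dyadic f)
  dyadic-NP∩coNP = (Verifying.verify M id , verify-accepts id) , (Verifying.verify M not , verify-accepts not)

  D : ℕ
  D = proj₁ (dominate (time M))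

  width : Word → ℕ
  width x = (2 + length x) ^ D

  numeral-width : ∀ x → numeral (digits (f x)) (width x) ≡ f x
  numeral-width x = numeral-digits (f x) (width x)
    (≤-trans (length-digits f M x (proj₁ (computes x)) (proj₂ (computes x)))
             (proj₂ (dominate (time M)) (length x)))

-- The three equivalences

count-concatMap : {A B : Set} (p : B → Bool) (g : A → List B) → ∀ xs →
  length (filterᵇ p (concatMap g xs)) ≡ sum (List.map (length ∘ filterᵇ p ∘ g) xs)
count-concatMap p g []       = refl
count-concatMap p g (x ∷ xs) = trans (count-++ p (g x) (concatMap g xs))
  (cong (length (filterᵇ p (g x)) +_) (count-concatMap p g xs))

sum-+ : {A : Set} (f g : A → ℕ) → ∀ xs →
  sum (List.map (λ x → f x + g x) xs) ≡ sum (List.map f xs) + sum (List.map g xs)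
sum-+ f g []       = refl
sum-+ f g (x ∷ xs) = trans (cong (f x + g x +_) (sum-+ f g xs))
  (interchange +-commutativeSemigroup (f x) (g x) (sum (List.map f xs)) (sum (List.map g xs)))

-- Gaps are turned into equations acc = gap + rej in ℕ, where the sums over the guesses are formed;
-- `sum⇒difference` returns to ℤ.
difference⇒sum : ∀ a r i → ℤ.+ a ℤ.- ℤ.+ r ≡ ℤ.+ i → a ≡ i + r
difference⇒sum a r i eq = ℤP.+-injective (begin
  ℤ.+ a                               ≡⟨ ℤP.+-identityʳ (ℤ.+ a) ⟨
  ℤ.+ a ℤ.+ ℤ.0ℤ                      ≡⟨ cong (λ j → ℤ.+ a ℤ.+ j) (ℤP.+-inverseˡ (ℤ.+ r)) ⟨
  ℤ.+ a ℤ.+ (ℤ.- ℤ.+ r ℤ.+ ℤ.+ r)     ≡⟨ ℤP.+-assoc (ℤ.+ a) (ℤ.- ℤ.+ r) (ℤ.+ r) ⟨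
  ℤ.+ a ℤ.- ℤ.+ r ℤ.+ ℤ.+ r           ≡⟨ cong (ℤ._+ ℤ.+ r) eq ⟩
  ℤ.+ (i + r)                         ∎)
  where open ≡-Reasoning

sum⇒difference : ∀ i r → ℤ.+ (i + r) ℤ.- ℤ.+ r ≡ ℤ.+ i
sum⇒difference i r = begin
  ℤ.+ i ℤ.+ ℤ.+ r ℤ.- ℤ.+ r           ≡⟨ ℤP.+-assoc (ℤ.+ i) (ℤ.+ r) (ℤ.- ℤ.+ r) ⟩
  ℤ.+ i ℤ.+ (ℤ.+ r ℤ.- ℤ.+ r)         ≡⟨ cong (λ j → ℤ.+ i ℤ.+ j) (ℤP.+-inverseʳ (ℤ.+ r)) ⟩
  ℤ.+ i ℤ.+ ℤ.0ℤ                      ≡⟨ ℤP.+-identityʳ (ℤ.+ i) ⟩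
  ℤ.+ i                               ∎
  where open ≡-Reasoning

module Guessing (N : NPTM) (f : Word → ℕ) (D : ℕ)
  (exact : ∀ x → numeral (digits (f x)) ((2 + length x) ^ D) ≡ f x) where

  open Asking N (0b ∷ 1b ∷ []) D

  acc-ask : ∀ x → acc ask x ≡ sum (List.map (λ ys → acc N (query ys x)) (asked x))
  acc-ask x = trans (count-cong (Pw.map proj₁ (ends-asker x)))
    (count-concatMap accepting (λ ys → outcomes N (query ys x)) (asked x))

  rej-ask : ∀ x → rej ask x ≡ sum (List.map (λ ys → rej N (query ys x)) (asked x))
  rej-ask x = trans (count-cong (Pw.map proj₂ (ends-asker x)))
    (count-concatMap rejecting (λ ys → outcomes N (query ys x)) (asked x))

  sum-dyadic : ∀ x → sum (List.map (λ ys → indicator (dyadic f) (query ys x)) (asked x)) ≡ f x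
  sum-dyadic x = trans
    (cong sum (map-cong (λ ys → cong (λ b → if b then 1 else 0) (dyadic-query f ys x)) (asked x)))
    (trans (sum-holding (digits (f x)) ((2 + length x) ^ D)) (exact x))

  ask-#P : (∀ w → acc N w ≡ indicator (dyadic f) w) → #P f
  ask-#P acc-N = ask , λ x → sym (trans (acc-ask x)
    (trans (cong sum (map-cong (λ ys → acc-N (query ys x)) (asked x))) (sum-dyadic x)))

  -- Gaps add up over the guesses: each query contributes its indicator, and the rejecting paths of
  -- `N` add up to `rej ask x`.
  ask-GapP : (∀ w → gap N w ≡ ℤ.+ indicator (dyadic f) w) → GapP₊ f
  ask-GapP gap-N = ask , λ x → sym (trans
    (cong (λ a → ℤ.+ a ℤ.- ℤ.+ rej ask x) (acc-rej x)) (sum⇒difference (f x) (rej ask x)))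
    where
    open ≡-Reasoning
    acc-rej : ∀ x → acc ask x ≡ f x + rej ask x
    acc-rej x = begin
      acc ask x ≡⟨ acc-ask x ⟩
      sum (List.map (λ ys → acc N (query ys x)) (asked x))
        ≡⟨ cong sum (map-cong (λ ys → difference⇒sum (acc N (query ys x)) (rej N (query ys x)) _
             (gap-N (query ys x))) (asked x)) ⟩
      sum (List.map (λ ys → indicator (dyadic f) (query ys x) + rej N (query ys x)) (asked x))
        ≡⟨ sum-+ _ _ (asked x) ⟩
      _ ≡⟨ cong₂ _+_ (sum-dyadic x) (sym (rej-ask x)) ⟩
      f x + rej ask x ∎

module Deciding (N : NPTM) (det : Deterministic (machine N)) (f : Word → ℕ)
  (N-accepts : N Accepts dyadic f) (D : ℕ)
  (exact : ∀ x → numeral (digits (f x)) ((2 + length x) ^ D) ≡ f x) where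

  open Looping N det
  open Summing (dyadic f) N-accepts
  -- A single choice turns guessing into unary counting: `ask` reaches `loop` along one path, with
  -- padding 1...1.
  open Asking loop (1b ∷ []) D

  ones : ℕ → Word
  ones m = replicate m 1b

  wordsOver-1 : ∀ m → wordsOver [ 1b ] m ≡ [ ones m ]
  wordsOver-1 zero    = refl
  wordsOver-1 (suc m) = cong (λ ws → List.map (1b ∷_) ws ++ []) (wordsOver-1 m)

  -- All pairs of the padding are equal, so the pair pushed first may be taken for the one in front.
  query-suc : ∀ m w → pushPairs 1b (ones m) (1b ∷ 1b ∷ w) ≡ 1b ∷ 1b ∷ pushPairs 1b (ones m) w
  query-suc zero    w = refl
  query-suc (suc m) w = query-suc m (1b ∷ 1b ∷ w)

  pushPairs₀-leads : ∀ u w → lead w ≡ 0 × value w ≡ 0 →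
    lead (pushPairs 0b u w) ≡ 0 × value (pushPairs 0b u w) ≡ 0
  pushPairs₀-leads []      w p = p
  pushPairs₀-leads (b ∷ u) w p = pushPairs₀-leads u (0b ∷ b ∷ w) (refl , refl)

  lead-query : ∀ m x → lead (query (ones m) x) ≡ m
  lead-query zero    x = proj₁ (pushPairs₀-leads x [] (refl , refl))
  lead-query (suc m) x = trans (cong lead (query-suc m _)) (cong suc (lead-query m x))

  -- The padding 1...1 of length m + 1 has the form 1u with |u| = m, so its query asks for the digit
  -- of weight 2 ^ m, and `lead` of what follows supplies that exponent.
  value-query : ∀ m x → value (query (ones m) x) ≡ numeral (digits (f x)) m
  value-query zero    x = proj₂ (pushPairs₀-leads x [] (refl , refl))
  value-query (suc m) x = begin
    value (query (ones (suc m)) x)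
      ≡⟨ cong value (query-suc m _) ⟩
    summand (1b ∷ 1b ∷ query (ones m) x) (2 ^ lead (query (ones m) x)) + value (query (ones m) x)
      ≡⟨ cong₂ _+_ (cong₂ (λ b n → if b then 2 ^ n else 0) digit (lead-query m x)) (value-query m x) ⟩
    numeral (digits (f x)) (suc m) ∎
    where
    open ≡-Reasoning
    digit : dyadic f (1b ∷ 1b ∷ query (ones m) x) ≡ digitAt (digits (f x)) m
    digit = begin
      dyadic f (1b ∷ 1b ∷ query (ones m) x)  ≡⟨ cong (dyadic f) (query-suc m _) ⟨
      dyadic f (query (ones (suc m)) x)      ≡⟨ dyadic-query f (ones (suc m)) x ⟩
      digitAt (digits (f x)) (length (ones m)) ≡⟨ cong (digitAt (digits (f x))) (length-replicate m) ⟩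
      digitAt (digits (f x)) m               ∎

  ask-TotP : TotP f
  ask-TotP = ask , λ x → sym (cong pred (total x))
    where
    open ≡-Reasoning
    total : ∀ x → Total ask x ≡ suc (f x)
    total x = begin
      Total ask x ≡⟨ Pw.Pointwise-length (ends-asker x) ⟩
      length (concatMap (λ ys → outcomes loop (query ys x)) (asked x))
        ≡⟨ cong (length ∘ concatMap (λ ys → outcomes loop (query ys x))) (wordsOver-1 ((2 + length x) ^ D)) ⟩
      length (outcomes loop (query (ones ((2 + length x) ^ D)) x) ++ [])
        ≡⟨ cong length (++-identityʳ (outcomes loop (query (ones ((2 + length x) ^ D)) x))) ⟩
      Total loop (query (ones ((2 + length x) ^ D)) x)
        ≡⟨ Total-loop _ ⟩
      suc (value (query (ones ((2 + length x) ^ D)) x))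
        ≡⟨ cong suc (trans (value-query ((2 + length x) ^ D) x) (exact x)) ⟩
      suc (f x) ∎

∁∁-NP : ∀ {L} → NP L → coNP (∁ L)
∁∁-NP {L} (M , acc) = M , λ x →
  subst (λ b → b ≡ true ⇔ 0 < _) (sym (not-involutive (L x))) (acc x)

indicator-NPSV : ∀ {L} → (NP ∩ coNP) L → NPSVₜ (indicator L)
indicator-NPSV {L} ((M₁ , acc₁) , (M₂ , acc₂)) = Choosing.indicator-NPSVₜ M₁ M₂ L acc₁ acc₂

P⊆NP∩coNP : P ⊆ NP ∩ coNP
P⊆NP∩coNP {L} (M , det , acc) = (M , acc) , (Flipping.flip M , Flipping.flip-accepts M det L acc)

UP⊆NP : UP ⊆ NP
UP⊆NP {L} (f , (M , f≡acc) , values) = M , λ x → mk⇔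
  (λ Lx → subst (0 <_) (trans (sym (proj₁ (values x) Lx)) (f≡acc x)) (s≤s z≤n))
  (λ pos → positive (L x) refl pos)
  where
  positive : ∀ {x} b → L x ≡ b → 0 < acc M x → L x ≡ true
  positive     true  eq _   = eq
  positive {x} false eq pos =
    ⊥-elim (n≮0 (subst (0 <_) (trans (sym (f≡acc x)) (proj₂ (values x) eq)) pos))

indicator-values : ∀ L x → (L x ≡ true → indicator L x ≡ 1) × (L x ≡ false → indicator L x ≡ 0)
indicator-values L x = cong (λ b → if b then 1 else 0) , cong (λ b → if b then 1 else 0)

-- UP and SPP prescribe their witness function by cases; `g` is the identity of ℕ or the embedding
-- into ℤ.
values-indicator : {A : Set} (g : ℕ → A) → ∀ {L x y} →
  (L x ≡ true → y ≡ g 1) × (L x ≡ false → y ≡ g 0) → y ≡ g (indicator L x)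
values-indicator g {L} {x} (if-1 , if-0) with L x
... | true  = if-1 refl
... | false = if-0 refl

TotP⇒P : ∀ {L} → TotP (indicator L) → P L
TotP⇒P {L} (M , tots) = Detecting.detectNPTM M , Detecting.detector-deterministic M ,
  Detecting.detects-branching M L (λ x → branches (L x) (Total M x) (tots x))
  where
  branches : ∀ b n → (if b then 1 else 0) ≡ pred n → b ≡ (1 <ᵇ n)
  branches true  2       _ = refl
  branches false 0       _ = refl
  branches false 1       _ = refl

proposition4p2 : (NPSVₜ ⊆ TotP  ⇔ P ≐ NP ∩ coNP)
    × (NPSVₜ ⊆ #P    ⇔ UP ∩ coUP ≐ NP ∩ coNP)
    × (NPSVₜ ⊆ GapP₊ ⇔ NP ∩ coNP ⊆ SPP)
proposition4p2 =
    mk⇔ (λ h → (λ {L} → P⊆NP∩coNP {L}) , (λ {L} L∈ → TotP⇒P {L} (h (indicator-NPSV {L} L∈))))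
        (λ P≐ {f} (M , computes) →
          let open Digits f M computes
              N , det , acc = proj₂ P≐ dyadic-NP∩coNP
          in Deciding.ask-TotP N det f acc D numeral-width)
  , mk⇔ (λ h →
            (λ {L} (up , coup) → UP⊆NP {L} up , UP⊆NP {∁ L} coup)
          -- NP ∩ coNP is closed under complement, so the hypothesis applies to the indicators of
          -- both `L` and `∁ L`.
          , (λ {L} (np , conp) →
              (_ , h (indicator-NPSV {L} (np , conp)) , indicator-values L) ,
              (_ , h (indicator-NPSV {∁ L} (conp , ∁∁-NP {L} np)) , indicator-values (∁ L))))
        (λ UP≐ {f} (M , computes) →
          let open Digits f M computes
              (g , (N , g≡acc) , values) , _ = proj₂ UP≐ dyadic-NP∩coNP
          in Guessing.ask-#P N f D numeral-width
               (λ w → trans (sym (g≡acc w)) (values-indicator id {dyadic f} {w} (values w))))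
  , mk⇔ (λ h {L} L∈ → (_ , h (indicator-NPSV {L} L∈) ,
            λ x → let if-1 , if-0 = indicator-values L x in cong (λ n → ℤ.+ n) ∘ if-1 , cong (λ n → ℤ.+ n) ∘ if-0))
        (λ ⊆SPP {f} (M , computes) →
          let open Digits f M computes
              g , (N , g≡gap) , values = ⊆SPP dyadic-NP∩coNP
          in Guessing.ask-GapP N f D numeral-width
               (λ w → trans (sym (g≡gap w)) (values-indicator (λ n → ℤ.+ n) {dyadic f} {w} (values w))))
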